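{- Let $\mathcal{H}$ be a hypergraph on a finite vertex set $V$, let $p\in[0,1]$, $\alpha\in(0,1]$ and $\eta\in(0,1]$. Writing $\mu=\mu_p(\mathcal{H})$ and $\Delta=\Delta_p(\mathcal{H})$, \[ \Pr\big(\nu(\mathcal{H}[V_p])\le \alpha\mu\big)\le \exp\Big(-\big(1-\alpha\log(e/\alpha)-\alpha p-\eta\big)\mu+\big(1+2\alpha p/\eta\big)\Delta\Big). \]
   Context: $V_p$ denotes the random subset of $V$ containing each element independently with probability $p$. For $W\subseteq V$, $\mathcal{H}[W]=\{A\in\mathcal{H}: A\subseteq W\}$. $\nu(\cdot)$ is the matching number (largest number of pairwise disjoint edges). $\mu_p(\mathcal{H})=\sum_{A\in\mathcal{H}}p^{|A|}$ and $\Delta_p(\mathcal{H})=\sum p^{|A\cup B|}$, the sum over unordered pairs $\{A,B\}$ of distinct edges of $\mathcal{H}$ with $A\cap B\neq\emptyset$. -}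

module Defs where

open import Level using (_⊔_) renaming (suc to lsuc)
open import Algebra.Apartness.Bundles using (HeytingCommutativeRing; HeytingField)
open import Algebra.Bundles using (CommutativeRing; Semiring)
import Algebra.Apartness.Properties.HeytingCommutativeRing as HCRProperties
import Algebra.Definitions.RawSemiring as RawSemiringDefs
import Algebra.Properties.Ring as RingProperties
open import Data.Bool.Base using (if_then_else_)
open import Data.Empty using (⊥-elim)
open import Data.Fin.Base using (Fin; toℕ)
open import Data.Fin.Subset using (Subset; inside; outside; Empty; _∩_; _∪_; ∣_∣)
open import Data.Fin.Subset.Properties using (nonempty?; _⊆?_)
open import Data.List.Base using (List; []; _∷_; _++_; foldr; map; filter; length)
open import Data.List.Extrema.Nat using (max)
open import Data.List.Relation.Unary.AllPairs using (allPairs?)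
open import Data.List.Relation.Unary.Unique.Propositional using (Unique)
import Data.List.Relation.Unary.Unique.Propositional.Properties as Unique
open import Data.Nat.Base as ℕ using (ℕ; zero; suc; NonZero; _!) renaming (_≤_ to _≤ℕ_)
open import Data.Nat.Properties using (m≤n+m; _!≢0)
open import Data.Product.Base using (∃-syntax; _×_; _,_; proj₁; proj₂)
open import Data.Sum.Base as Sum using (_⊎_; inj₁; inj₂)
open import Data.Vec.Base using ([]; _∷_; lookup)
open import Relation.Binary.Core using (Rel)
import Relation.Binary.Definitions as B
open import Relation.Binary.Structures using (IsStrictPartialOrder)
open import Relation.Nullary.Decidable using (¬?)
open import Relation.Nullary.Negation using (¬_)
open import Relation.Unary using (Pred; Decidable)

------------------------------------------------------------------------
-- Real numbers
--
-- The standard library has no type of real numbers, so ℝ is given by its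
-- axiomatic characterisation: a Cauchy-complete Archimedean ordered field.
-- Classically (with _#_ being ≠) such a field is unique up to isomorphism.
-- Decidability of the order is not assumed, so that constructive
-- (Cauchy or Bishop) reals also satisfy the axioms.

module Sequences {c ℓ₁ ℓ₂} (F : HeytingField c ℓ₁ ℓ₂)
                 (_<_ : Rel (HeytingField.Carrier F) ℓ₂) where
  open HeytingField F

  -- |x - y| < ε
  Within : Carrier → Carrier → Carrier → Set ℓ₂
  Within ε x y = (x < (y + ε)) × (y < (x + ε))

  Cauchy : (ℕ → Carrier) → Set (c ⊔ ℓ₂)
  Cauchy s = ∀ ε → 0# < ε →
    ∃[ N ] (∀ m n → N ≤ℕ m → N ≤ℕ n → Within ε (s m) (s n))

  _⟶_ : (ℕ → Carrier) → Carrier → Set (c ⊔ ℓ₂)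
  s ⟶ l = ∀ ε → 0# < ε → ∃[ N ] (∀ n → N ≤ℕ n → Within ε (s n) l)

record RealField c ℓ₁ ℓ₂ : Set (lsuc (c ⊔ ℓ₁ ⊔ ℓ₂)) where
  infix 4 _<_ _≤_
  field
    heytingField : HeytingField c ℓ₁ ℓ₂

  open HeytingField heytingField public

  commutativeRing : CommutativeRing c ℓ₁
  commutativeRing = HeytingCommutativeRing.commutativeRing
    (HeytingField.heytingCommutativeRing heytingField)

  open CommutativeRing commutativeRing public using (ring; semiring)
  open RawSemiringDefs (Semiring.rawSemiring semiring) public
    using (_^_; sum; product) renaming (_×_ to _·_)

  fromℕ : ℕ → Carrier
  fromℕ n = n · 1#

  field
    _<_                  : Rel Carrier ℓ₂
    isStrictPartialOrder : IsStrictPartialOrder _≈_ _<_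
    <⇒#                  : ∀ {x y} → x < y → x # y
    #⇒<⊎>                : ∀ {x y} → x # y → x < y ⊎ y < x
    +-monoˡ-<            : ∀ {x y} z → x < y → x + z < y + z
    *-pos                : ∀ {x y} → 0# < x → 0# < y → 0# < x * y
    archimedean          : ∀ x → ∃[ n ] x < fromℕ n

  open Sequences heytingField _<_ public

  field
    complete : ∀ s → Cauchy s → ∃[ l ] s ⟶ l

  -- Constructively, x ≤ y is the negation of y < x.
  _≤_ : Rel Carrier ℓ₂
  x ≤ y = ¬ (y < x)

module Reals {c ℓ₁ ℓ₂} (R : RealField c ℓ₁ ℓ₂) where
  open RealField R public

  open IsStrictPartialOrder isStrictPartialOrder public
    using (<-respˡ-≈; <-respʳ-≈)
    renaming (irrefl to <-irrefl; trans to <-trans; asym to <-asym)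

  open HCRProperties (HeytingField.heytingCommutativeRing heytingField) public
    using (1#0; x-0≈x; invertibleʳ⇒#)
  private module RP = RingProperties ring

  0<1 : 0# < 1#
  0<1 with #⇒<⊎> 1#0
  ... | inj₂ 0<1 = 0<1
  ... | inj₁ 1<0 = <-respʳ-≈ -1*-1≈1 (*-pos 0<-1 0<-1)
    where
    0<-1 : 0# < - 1#
    0<-1 = <-respˡ-≈ (-‿inverseʳ 1#) (<-respʳ-≈ (+-identityˡ (- 1#)) (+-monoˡ-< (- 1#) 1<0))
    -1*-1≈1 : - 1# * - 1# ≈ 1#
    -1*-1≈1 = trans (RP.-1*x≈-x (- 1#)) (RP.-‿involutive 1#)

  x<y+x : ∀ {x y} → 0# < y → x < y + x
  x<y+x {x} 0<y = <-respˡ-≈ (+-identityˡ x) (+-monoˡ-< x 0<y)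

  x<y+x⁻¹ : ∀ {x y} → x < y + x → 0# < y
  x<y+x⁻¹ {x} {y} x<y+x = <-respˡ-≈ (-‿inverseʳ x) (<-respʳ-≈ y+x-x≈y (+-monoˡ-< (- x) x<y+x))
    where
    y+x-x≈y : y + x + - x ≈ y
    y+x-x≈y = trans (+-assoc y x (- x)) (trans (+-congˡ (-‿inverseʳ x)) (+-identityʳ y))

  +-pos : ∀ {x y} → 0# < x → 0# < y → 0# < x + y
  +-pos 0<x 0<y = <-trans 0<y (x<y+x 0<x)

  fromℕ-pos : ∀ n → .{{NonZero n}} → 0# < fromℕ n
  fromℕ-pos (suc zero)      = <-respʳ-≈ (sym (+-identityʳ 1#)) 0<1
  fromℕ-pos (suc n@(suc _)) = +-pos 0<1 (fromℕ-pos n)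

  ^-pos : ∀ {x} n → 0# < x → 0# < x ^ n
  ^-pos zero    0<x = 0<1
  ^-pos (suc n) 0<x = *-pos 0<x (^-pos n 0<x)

  sum-pos : ∀ n (f : Fin (suc n) → Carrier) → (∀ i → 0# < f i) → 0# < sum f
  sum-pos zero    f f>0 = <-respʳ-≈ (sym (+-identityʳ _)) (f>0 Fin.zero)
  sum-pos (suc n) f f>0 = +-pos (f>0 Fin.zero) (sum-pos n (λ i → f (Fin.suc i)) (λ i → f>0 (Fin.suc i)))

  -- Division by positive numbers only.

  recip : ∀ y → 0# < y → Carrier
  recip y 0<y = proj₁ (#⇒invertible (#-sym (<⇒# 0<y)))

  *-recipʳ : ∀ y (0<y : 0# < y) → y * recip y 0<y ≈ 1#
  *-recipʳ y 0<y = trans (*-congʳ (sym (x-0≈x y))) (proj₂ (proj₂ (#⇒invertible (#-sym (<⇒# 0<y)))))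

  recip-pos : ∀ y (0<y : 0# < y) → 0# < recip y 0<y
  recip-pos y 0<y = Sum.[ (λ z<0 → ⊥-elim (<-asym 0<1 (1<0 z<0))) , (λ 0<z → 0<z) ]′ (#⇒<⊎> z#0)
    where
    z : Carrier
    z = recip y 0<y
    z#0 : z # 0#
    z#0 = invertibleʳ⇒# (y , trans (*-congʳ (x-0≈x z)) (trans (*-comm z y) (*-recipʳ y 0<y)))
    0<-z : z < 0# → 0# < - z
    0<-z z<0 = <-respˡ-≈ (-‿inverseʳ z) (<-respʳ-≈ (+-identityˡ (- z)) (+-monoˡ-< (- z) z<0))
    y*-z≈-1 : y * - z ≈ - 1#
    y*-z≈-1 = trans (sym (RP.-‿distribʳ-* y z)) (-‿cong (*-recipʳ y 0<y))
    1<0 : z < 0# → 1# < 0#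
    1<0 z<0 = <-respʳ-≈ (-‿inverseˡ 1#) (x<y+x (<-respʳ-≈ y*-z≈-1 (*-pos 0<y (0<-z z<0))))

  infixl 7 _/_⟨_⟩
  _/_⟨_⟩ : ∀ (x y : Carrier) → 0# < y → Carrier
  x / y ⟨ 0<y ⟩ = x * recip y 0<y

  /-pos : ∀ {x y} → 0# < x → (0<y : 0# < y) → 0# < x / y ⟨ 0<y ⟩
  /-pos {y = y} 0<x 0<y = *-pos 0<x (recip-pos y 0<y)

  expTerm : Carrier → ℕ → Carrier
  expTerm x k = x ^ k / fromℕ (k !) ⟨ fromℕ-pos (k !) {{k !≢0}} ⟩

  expPartialSum : Carrier → ℕ → Carrier
  expPartialSum x n = sum {n} (λ k → expTerm x (toℕ k))

-- The exponential function is the sum of Σ xᵏ/k!, and the logarithm is its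
-- inverse on the positive reals.  These laws determine both functions.

record ExpLog {c ℓ₁ ℓ₂} (R : RealField c ℓ₁ ℓ₂) : Set (c ⊔ ℓ₁ ⊔ ℓ₂) where
  open Reals R
  field
    exp        : Carrier → Carrier
    exp-series : ∀ x → expPartialSum x ⟶ exp x
    log        : ∀ x → 0# < x → Carrier
    exp-log    : ∀ x (0<x : 0# < x) → exp (log x 0<x) ≈ x

  e : Carrier
  e = exp 1#

  0<e : 0# < e
  0<e = x<y+x⁻¹ (<-trans h<s (proj₁ (proj₂ close (2 ℕ.+ N) (m≤n+m N 2))))
    where
    expTerm-pos : ∀ k → 0# < expTerm 1# k
    expTerm-pos k = /-pos (^-pos k 0<1) (fromℕ-pos (k !) {{k !≢0}})
    close = exp-series 1# (expTerm 1# 0) (expTerm-pos 0)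
    N = proj₁ close
    h<s : expTerm 1# 0 < expPartialSum 1# (2 ℕ.+ N)
    h<s = <-respʳ-≈ (+-comm _ _)
      (x<y+x (sum-pos N (λ i → expTerm 1# (suc (toℕ i))) (λ i → expTerm-pos (suc (toℕ i)))))

------------------------------------------------------------------------
-- Hypergraphs on the vertex set Fin n

record Hypergraph (n : ℕ) : Set where
  constructor hypergraph
  field
    edges  : List (Subset n)
    unique : Unique edges

open Hypergraph public

_⟦_⟧ : ∀ {n} → Hypergraph n → Subset n → Hypergraph n
H ⟦ W ⟧ = hypergraph (filter (_⊆? W) (edges H)) (Unique.filter⁺ (_⊆? W) (unique H))

Disjoint : ∀ {n} → Rel (Subset n) _
Disjoint A B = Empty (A ∩ B)

disjoint? : ∀ {n} → B.Decidable (Disjoint {n})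
disjoint? A B = ¬? (nonempty? (A ∩ B))

sublists : ∀ {a} {A : Set a} → List A → List (List A)
sublists []       = [] ∷ []
sublists (x ∷ xs) = map (x ∷_) (sublists xs) ++ sublists xs

matchings : ∀ {n} → Hypergraph n → List (List (Subset n))
matchings H = filter (allPairs? disjoint?) (sublists (edges H))

ν : ∀ {n} → Hypergraph n → ℕ
ν H = max 0 (map length (matchings H))

-- Each unordered pair of entries at distinct positions occurs once.
pairs : ∀ {a} {A : Set a} → List A → List (A × A)
pairs []       = []
pairs (x ∷ xs) = map (x ,_) xs ++ pairs xs

intersectingPairs : ∀ {n} → Hypergraph n → List (Subset n × Subset n)
intersectingPairs H = filter (λ (A , B) → nonempty? (A ∩ B)) (pairs (edges H))

subsets : ∀ n → List (Subset n)
subsets zero    = [] ∷ []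
subsets (suc n) = map (inside ∷_) (subsets n) ++ map (outside ∷_) (subsets n)

------------------------------------------------------------------------
-- The random subset V_p and the weights μ_p, Δ_p

module Weights {c ℓ₁ ℓ₂} (R : RealField c ℓ₁ ℓ₂) where
  open Reals R

  sumOver : ∀ {a} {A : Set a} → List A → (A → Carrier) → Carrier
  sumOver xs f = foldr (λ x s → f x + s) 0# xs

  -- The probability that V_p = W.
  outcomeProbability : ∀ {n} → Carrier → Subset n → Carrier
  outcomeProbability {n} p W =
    product {n} (λ v → if lookup W v then p else 1# - p)

  -- The probability that V_p lies in the event E.  Summing over E requires
  -- a decision procedure, which classically always exists; the value does
  -- not depend on it.
  Pr : ∀ {n ℓ} → Carrier → {E : Pred (Subset n) ℓ} → Decidable E → Carrier
  Pr {n} p E? = sumOver (filter E? (subsets n)) (outcomeProbability p)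

  μ : ∀ {n} → Carrier → Hypergraph n → Carrier
  μ p H = sumOver (edges H) (λ A → p ^ ∣ A ∣)

  Δ : ∀ {n} → Carrier → Hypergraph n → Carrier
  Δ p H = sumOver (intersectingPairs H) (λ (A , B) → p ^ ∣ A ∪ B ∣)

{-# OPTIONS --safe #-}

-- Greedily, ν(H[V_p]) ≤ αμ yields a maximal matching M in V_p with at most αμ
-- edges; no edge disjoint from M then lies in V_p, which by Janson's inequality
-- has probability at most exp(-μ(rest) + Δ), and the union bound over M costs
-- Σ_M Π_{A∈M} p^|A|.  Tilting by α^(|M| - αμ) turns this sum into
-- α^(-αμ) Π_A (1 + α p^|A|) ≤ (e/α)^(αμ).  Edges A for which the other edges
-- meeting A have mass more than η/α are first discarded: by
-- Σ_A p^|A| Σ_{B∼A} p^|B| ≤ 2pΔ they have mass at most 2αpΔ/η, and afterwards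
-- each edge of M removes at most p + η/α from the mass of the rest.  Empty edges
-- of H belong to every maximal matching and are counted separately.
module Submission where

open import Defs
open import Data.Nat.Base using (ℕ)
open import Data.Fin.Subset using (Subset)
open import Relation.Unary using (Decidable)
open import Algebra.Bundles using (CommutativeRing)

-- A matching edge may meet edges of large total mass, while Δ controls only the average of these
-- masses. Discarding bad edges makes the loss per matching edge uniform, so a tilt linear in the
-- size of M can absorb it. The threshold η/α is the one at which αμ matching edges lose ημ. If the
-- discarded mass is D, the exponent suffers by (1 - α) D, and this is how 2αpΔ/η comes to stand
-- beside Janson's Δ. Empty edges obstruct this argument: such an edge has weight 1 instead of at
-- most p, and it does not even meet itself. Setting ε of them aside lowers the size allowed to M
-- from αμ to αμ - ε. With tilt rate ℓ + κ, where ℓ = log(e/α) - 1, this gains (ℓ + κ) ε in the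
-- exponent, which outweighs the lost (1 - α) ε because ℓ ≥ 1 - α. `exp` is given by its power
-- series alone, so its functional equation and 1 + x ≤ exp x have to be derived. The order is
-- undecidable, and separating good edges from bad ones is legitimate only because the goal is a
-- negation.

-- Ring solver with integer coefficients.

module IntegerCoefficientSolver {c ℓ} (R : CommutativeRing c ℓ) where
  open CommutativeRing R
  open import Algebra.Properties.Ring ring
    using (-0#≈0#; -‿involutive; -‿distribˡ-*; -‿distribʳ-*; -‿+-comm)
  open import Algebra.Properties.Semiring.Mult.TCOptimised semiring
    using (_×_; ×-homo-+; ×1-homo-*; 1+×)
  open import Algebra.Solver.Ring.AlmostCommutativeRing
    using (fromCommutativeRing; _-Raw-AlmostCommutative⟶_)
  open import Data.Integer.Base as ℤ using (ℤ; +_; -[1+_]; _⊖_)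
  import Data.Integer.Properties as ℤ
  open import Data.Maybe.Base using (Maybe; map)
  open import Data.Nat.Base as ℕ using (ℕ; zero; suc)
  open import Relation.Binary.PropositionalEquality as ≡ using (_≡_)
  open import Relation.Nullary.Decidable using (dec⇒maybe)
  open import Relation.Binary.Reasoning.Setoid setoid

  -- With the optimised multiple, `1 × 1#` reduces to `1#`, so the solver constants `:0` and `:1`
  -- denote `0#` and `1#` definitionally.
  fromℤ : ℤ → Carrier
  fromℤ (+ n)    = n × 1#
  fromℤ -[1+ n ] = - (suc n × 1#)

  private
    x≈x-0 : ∀ x → x ≈ x - 0#
    x≈x-0 x = sym (trans (+-congˡ -0#≈0#) (+-identityʳ x))

    shift : ∀ x y → x - y ≈ (1# + x) - (1# + y)
    shift x y = begin
      x - y                    ≈⟨ +-identityˡ (x - y) ⟨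
      0# + (x - y)             ≈⟨ +-congʳ (-‿inverseʳ 1#) ⟨
      (1# - 1#) + (x - y)      ≈⟨ +-assoc 1# (- 1#) (x - y) ⟩
      1# + (- 1# + (x - y))    ≈⟨ +-congˡ (+-assoc (- 1#) x (- y)) ⟨
      1# + ((- 1# + x) - y)    ≈⟨ +-congˡ (+-congʳ (+-comm (- 1#) x)) ⟩
      1# + ((x - 1#) - y)      ≈⟨ +-congˡ (+-assoc x (- 1#) (- y)) ⟩
      1# + (x + (- 1# - y))    ≈⟨ +-congˡ (+-congˡ (-‿+-comm 1# y)) ⟩
      1# + (x - (1# + y))      ≈⟨ +-assoc 1# x (- (1# + y)) ⟨
      (1# + x) - (1# + y)      ∎

    fromℤ-⊖ : ∀ m n → fromℤ (m ⊖ n) ≈ m × 1# - n × 1#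
    fromℤ-⊖ zero    zero    = x≈x-0 0#
    fromℤ-⊖ zero    (suc n) = sym (+-identityˡ _)
    fromℤ-⊖ (suc m) zero    = x≈x-0 _
    fromℤ-⊖ (suc m) (suc n) = begin
      fromℤ (suc m ⊖ suc n)                ≡⟨ ≡.cong fromℤ (ℤ.[1+m]⊖[1+n]≡m⊖n m n) ⟩
      fromℤ (m ⊖ n)                        ≈⟨ fromℤ-⊖ m n ⟩
      m × 1# - n × 1#                      ≈⟨ shift _ _ ⟩
      (1# + m × 1#) - (1# + n × 1#)        ≈⟨ +-cong (1+× m 1#) (-‿cong (1+× n 1#)) ⟨
      suc m × 1# - suc n × 1#              ∎

    fromℤ-neg : ∀ i → fromℤ (ℤ.- i) ≈ - fromℤ i
    fromℤ-neg (+ zero)    = sym -0#≈0#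
    fromℤ-neg (+ (suc n)) = refl
    fromℤ-neg -[1+ n ]    = sym (-‿involutive _)

    fromℤ-+ : ∀ i j → fromℤ (i ℤ.+ j) ≈ fromℤ i + fromℤ j
    fromℤ-+ (+ m)    (+ n)    = ×-homo-+ 1# m n
    fromℤ-+ (+ m)    -[1+ n ] = fromℤ-⊖ m (suc n)
    fromℤ-+ -[1+ m ] (+ n)    = trans (fromℤ-⊖ n (suc m)) (+-comm _ _)
    fromℤ-+ -[1+ m ] -[1+ n ] = begin
      - (suc (suc (m ℕ.+ n)) × 1#)      ≡⟨ ≡.cong (λ k → - (k × 1#)) (ℕ.+-suc (suc m) n) ⟨
      - ((suc m ℕ.+ suc n) × 1#)        ≈⟨ -‿cong (×-homo-+ 1# (suc m) (suc n)) ⟩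
      - (suc m × 1# + suc n × 1#)       ≈⟨ -‿+-comm _ _ ⟨
      - (suc m × 1#) - suc n × 1#       ∎
      where import Data.Nat.Properties as ℕ

    fromℤ-* : ∀ i j → fromℤ (i ℤ.* j) ≈ fromℤ i * fromℤ j
    fromℤ-* (+ m) (+ n) =
      trans (reflexive (≡.cong fromℤ (ℤ.+◃n≡+n (m ℕ.* n)))) (×1-homo-* m n)
    fromℤ-* (+ m) -[1+ n ] = begin
      fromℤ (+ m ℤ.* -[1+ n ])             ≡⟨ ≡.cong fromℤ (ℤ.-◃n≡-n (m ℕ.* suc n)) ⟩
      fromℤ (ℤ.- + (m ℕ.* suc n))          ≈⟨ fromℤ-neg (+ (m ℕ.* suc n)) ⟩
      - ((m ℕ.* suc n) × 1#)               ≈⟨ -‿cong (×1-homo-* m (suc n)) ⟩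
      - (m × 1# * suc n × 1#)              ≈⟨ -‿distribʳ-* _ _ ⟩
      m × 1# * - (suc n × 1#)              ∎
    fromℤ-* -[1+ m ] (+ n) = begin
      fromℤ (-[1+ m ] ℤ.* + n)             ≡⟨ ≡.cong fromℤ (ℤ.-◃n≡-n (suc m ℕ.* n)) ⟩
      fromℤ (ℤ.- + (suc m ℕ.* n))          ≈⟨ fromℤ-neg (+ (suc m ℕ.* n)) ⟩
      - ((suc m ℕ.* n) × 1#)               ≈⟨ -‿cong (×1-homo-* (suc m) n) ⟩
      - (suc m × 1# * n × 1#)              ≈⟨ -‿distribˡ-* _ _ ⟩
      - (suc m × 1#) * n × 1#              ∎
    fromℤ-* -[1+ m ] -[1+ n ] = begin
      (suc m ℕ.* suc n) × 1#               ≈⟨ ×1-homo-* (suc m) (suc n) ⟩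
      suc m × 1# * suc n × 1#              ≈⟨ -‿involutive _ ⟨
      - - (suc m × 1# * suc n × 1#)        ≈⟨ -‿cong (-‿distribʳ-* _ _) ⟩
      - (suc m × 1# * - (suc n × 1#))      ≈⟨ -‿distribˡ-* _ _ ⟩
      - (suc m × 1#) * - (suc n × 1#)      ∎

  homomorphism : ℤ.+-*-rawRing -Raw-AlmostCommutative⟶ fromCommutativeRing R
  homomorphism = record
    { ⟦_⟧    = fromℤ
    ; +-homo = fromℤ-+
    ; *-homo = fromℤ-*
    ; -‿homo = fromℤ-neg
    ; 0-homo = refl
    ; 1-homo = refl
    }

  fromℤ-≟ : ∀ i j → Maybe (fromℤ i ≈ fromℤ j)
  fromℤ-≟ i j = map (λ i≡j → reflexive (≡.cong fromℤ i≡j)) (dec⇒maybe (i ℤ.≟ j))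

  open import Algebra.Solver.Ring _ _ homomorphism fromℤ-≟ public
    using (Polynomial; con; solve; _:=_; _:+_; _:*_; _:-_; :-_)

  :0 :1 : ∀ {n} → Polynomial n
  :0 = con (+ 0)
  :1 = con (+ 1)

-- Ordered field arithmetic with an undecidable order.

module Order {c ℓ₁ ℓ₂} (R : RealField c ℓ₁ ℓ₂) where
  open Reals R
  open IntegerCoefficientSolver commutativeRing public
  open import Algebra.Properties.Semiring.Mult semiring using (×-homo-+)
  open import Data.Empty using (⊥-elim)
  open import Data.Fin.Subset using (Subset; inside; outside)
  open import Data.Vec.Base using ([]; _∷_)
  open import Relation.Unary using (Decidable)
  open import Data.Nat.Base as ℕ using (ℕ; zero; suc)
  open import Data.Product.Base using (_,_; proj₁; proj₂)
  open import Data.Sum.Base using (_⊎_; inj₁; inj₂)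
  open import Relation.Binary.Bundles using (Poset)
  open import Relation.Nullary.Negation using (¬_)
  open import Relation.Nullary.Decidable using (Dec; yes; no)

  private variable
    u v x y z : Carrier

  -- The substitute for trichotomy: apartness is cotransitive, and whichever apartness it yields can
  -- be oriented.
  <-cotrans : x < z → ∀ y → x < y ⊎ y < z
  <-cotrans x<z y with #-cotrans (<⇒# x<z) y
  ... | inj₁ x#y with #⇒<⊎> x#y
  ...   | inj₁ x<y = inj₁ x<y
  ...   | inj₂ y<x = inj₂ (<-trans y<x x<z)
  <-cotrans x<z y | inj₂ y#z with #⇒<⊎> y#z
  ...   | inj₁ y<z = inj₂ y<z
  ...   | inj₂ z<y = inj₁ (<-trans x<z z<y)

  <⇒≤ : x < y → x ≤ y
  <⇒≤ = <-asym

  ≤-reflexive : x ≈ y → x ≤ y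
  ≤-reflexive x≈y = <-irrefl (sym x≈y)

  ≤-refl : x ≤ x
  ≤-refl = ≤-reflexive refl

  ≤-trans : x ≤ y → y ≤ z → x ≤ z
  ≤-trans {y = y} x≤y y≤z z<x with <-cotrans z<x y
  ... | inj₁ z<y = y≤z z<y
  ... | inj₂ y<x = x≤y y<x

  <-≤-trans : x < y → y ≤ z → x < z
  <-≤-trans {z = z} x<y y≤z with <-cotrans x<y z
  ... | inj₁ x<z = x<z
  ... | inj₂ z<y = ⊥-elim (y≤z z<y)

  ≤-<-trans : x ≤ y → y < z → x < z
  ≤-<-trans {x = x} x≤y y<z with <-cotrans y<z x
  ... | inj₁ y<x = ⊥-elim (x≤y y<x)
  ... | inj₂ x<z = x<z

  ≤-antisym : x ≤ y → y ≤ x → x ≈ y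
  ≤-antisym {x} {y} x≤y y≤x = proj₁ (tight x y) λ x#y → case (#⇒<⊎> x#y)
    where
    case : ¬ (x < y ⊎ y < x)
    case (inj₁ x<y) = y≤x x<y
    case (inj₂ y<x) = x≤y y<x

  poset : Poset c ℓ₁ ℓ₂
  poset = record
    { isPartialOrder = record
      { isPreorder = record
        { isEquivalence = isEquivalence
        ; reflexive     = ≤-reflexive
        ; trans         = ≤-trans
        }
      ; antisym = ≤-antisym
      }
    }

  module ≤-Reasoning where
    open import Relation.Binary.Reasoning.PartialOrder poset public

  -- The order is the negation of _<_, so a proof of an inequality may use
  -- excluded middle.

  ≤-byCases : ∀ {p} (P : Set p) → (Dec P → x ≤ y) → x ≤ y
  ≤-byCases P x≤y y<x = ¬P (λ p → x≤y (yes p) y<x)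
    where
    ¬P : ¬ ¬ P
    ¬P ¬p = x≤y (no ¬p) y<x

  ≰⇒≥ : ¬ (x ≤ y) → y ≤ x
  ≰⇒≥ x≰y x<y = x≰y (<⇒≤ x<y)

  ≤-byTotality : ∀ u v → (u ≤ v → x ≤ y) → (v ≤ u → x ≤ y) → x ≤ y
  ≤-byTotality u v u≤v⇒ v≤u⇒ = ≤-byCases (u ≤ v) λ where
    (yes u≤v) → u≤v⇒ u≤v
    (no u≰v)  → v≤u⇒ (≰⇒≥ u≰v)

  -- A predicate on `Subset n` asks only finitely many questions, so `≤-byCases` may settle them one
  -- at a time.
  ≤-byDecidability : ∀ n {p} (P : Subset n → Set p) → (Decidable P → x ≤ y) → x ≤ y
  ≤-byDecidability zero    P x≤y = ≤-byCases (P []) λ P? → x≤y λ { [] → P? }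
  ≤-byDecidability (suc n) P x≤y =
    ≤-byDecidability n (λ W → P (inside ∷ W)) λ in? →
    ≤-byDecidability n (λ W → P (outside ∷ W)) λ out? →
    x≤y λ { (inside ∷ W) → in? W ; (outside ∷ W) → out? W }

  0<⇒< : 0# < y - x → x < y
  0<⇒< {y} {x} 0<y-x = <-respˡ-≈ (+-identityˡ x)
    (<-respʳ-≈ (solve 2 (λ x y → (y :- x) :+ x := y) refl x y) (+-monoˡ-< x 0<y-x))

  <⇒0< : x < y → 0# < y - x
  <⇒0< {x} x<y = <-respˡ-≈ (-‿inverseʳ x) (+-monoˡ-< (- x) x<y)

  0≤⇒≤ : 0# ≤ y - x → x ≤ y
  0≤⇒≤ {y} {x} 0≤y-x y<x = 0≤y-x
    (<-respʳ-≈ (-‿inverseʳ x) (+-monoˡ-< (- x) y<x))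

  ≤⇒0≤ : x ≤ y → 0# ≤ y - x
  ≤⇒0≤ {x} {y} x≤y y-x<0 = x≤y (<-respʳ-≈ (+-identityˡ x)
    (<-respˡ-≈ (solve 2 (λ x y → (y :- x) :+ x := y) refl x y) (+-monoˡ-< x y-x<0)))

  -- Inequalities are proved by exhibiting the difference of the two sides
  -- as a visibly nonnegative expression.

  ≤-by : y - x ≈ z → 0# ≤ z → x ≤ y
  ≤-by y-x≈z 0≤z = 0≤⇒≤ (≤-trans 0≤z (≤-reflexive (sym y-x≈z)))

  <-by : y - x ≈ z → 0# < z → x < y
  <-by y-x≈z 0<z = 0<⇒< (<-respʳ-≈ (sym y-x≈z) 0<z)

  +-nonneg : 0# ≤ x → 0# ≤ y → 0# ≤ x + y
  +-nonneg {x} {y} 0≤x 0≤y = ≤-trans 0≤x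
    (≤-by (solve 2 (λ x y → (x :+ y) :- x := y) refl x y) 0≤y)

  -- If x * y were negative it would be invertible; then both factors are invertible, hence apart
  -- from zero, hence of known sign.
  *-nonneg : 0# ≤ x → 0# ≤ y → 0# ≤ x * y
  *-nonneg {x} {y} 0≤x 0≤y xy<0 = cases (#⇒<⊎> x#0) (#⇒<⊎> y#0)
    where
    xy#0 : (x * y) # 0#
    xy#0 = <⇒# xy<0
    i : Carrier
    i = proj₁ (#⇒invertible xy#0)
    xyi≈1 : x * y * i ≈ 1#
    xyi≈1 = trans (*-congʳ (sym (x-0≈x (x * y)))) (proj₂ (proj₂ (#⇒invertible xy#0)))
    x#0 : x # 0#
    x#0 = invertibleʳ⇒# (y * i , trans (*-congʳ (x-0≈x x)) (trans (sym (*-assoc x y i)) xyi≈1))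
    y#0 : y # 0#
    y#0 = invertibleʳ⇒# (x * i , trans (*-congʳ (x-0≈x y))
      (trans (solve 3 (λ x y i → y :* (x :* i) := x :* y :* i) refl x y i) xyi≈1))
    cases : (x < 0# ⊎ 0# < x) → ¬ (y < 0# ⊎ 0# < y)
    cases (inj₁ x<0) _          = 0≤x x<0
    cases (inj₂ _)   (inj₁ y<0) = 0≤y y<0
    cases (inj₂ 0<x) (inj₂ 0<y) = <-asym xy<0 (*-pos 0<x 0<y)

  +-mono-≤ : x ≤ y → u ≤ v → x + u ≤ y + v
  +-mono-≤ {x} {y} {u} {v} x≤y u≤v = ≤-by
    (solve 4 (λ x y u v → (y :+ v) :- (x :+ u) := (y :- x) :+ (v :- u)) refl x y u v)
    (+-nonneg (≤⇒0≤ x≤y) (≤⇒0≤ u≤v))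

  +-monoʳ-≤ : ∀ z → x ≤ y → z + x ≤ z + y
  +-monoʳ-≤ z x≤y = +-mono-≤ ≤-refl x≤y

  +-mono-< : x < y → u < v → x + u < y + v
  +-mono-< {x} {y} {u} {v} x<y u<v = <-by
    (solve 4 (λ x y u v → (y :+ v) :- (x :+ u) := (y :- x) :+ (v :- u)) refl x y u v)
    (+-pos (<⇒0< x<y) (<⇒0< u<v))

  neg-mono-≤ : x ≤ y → - y ≤ - x
  neg-mono-≤ {x} {y} x≤y = ≤-by
    (solve 2 (λ x y → :- x :- (:- y) := y :- x) refl x y) (≤⇒0≤ x≤y)

  *-monoˡ-≤ : 0# ≤ z → x ≤ y → x * z ≤ y * z
  *-monoˡ-≤ {z} {x} {y} 0≤z x≤y = ≤-by
    (solve 3 (λ x y z → y :* z :- x :* z := (y :- x) :* z) refl x y z)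
    (*-nonneg (≤⇒0≤ x≤y) 0≤z)

  *-monoʳ-≤ : 0# ≤ z → x ≤ y → z * x ≤ z * y
  *-monoʳ-≤ {z} {x} {y} 0≤z x≤y = ≤-by
    (solve 3 (λ x y z → z :* y :- z :* x := z :* (y :- x)) refl x y z)
    (*-nonneg 0≤z (≤⇒0≤ x≤y))

  *-mono-≤ : 0# ≤ x → 0# ≤ v → x ≤ y → u ≤ v → x * u ≤ y * v
  *-mono-≤ 0≤x 0≤v x≤y u≤v = ≤-trans (*-monoʳ-≤ 0≤x u≤v) (*-monoˡ-≤ 0≤v x≤y)

  *-cancelˡ-≈ : 0# < z → z * x ≈ z * y → x ≈ y
  *-cancelˡ-≈ {z} {x} {y} 0<z zx≈zy = trans (sym (recip-*-* x))
    (trans (*-congˡ zx≈zy) (recip-*-* y))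
    where
    recip-*-* : ∀ x → recip z 0<z * (z * x) ≈ x
    recip-*-* x = trans (sym (*-assoc _ _ _))
      (trans (*-congʳ (trans (*-comm _ _) (*-recipʳ z 0<z))) (*-identityˡ x))

  square-nonneg : ∀ x → 0# ≤ x * x
  square-nonneg x = ≤-byTotality 0# x (λ 0≤x → *-nonneg 0≤x 0≤x) λ x≤0 →
    ≤-trans (*-nonneg (≤⇒0≤ x≤0) (≤⇒0≤ x≤0))
      (≤-reflexive (solve 1 (λ x → (:0 :- x) :* (:0 :- x) := x :* x) refl x))

  0≤1 : 0# ≤ 1#
  0≤1 = <⇒≤ 0<1

  fromℕ-nonneg : ∀ n → 0# ≤ fromℕ n
  fromℕ-nonneg zero    = ≤-refl
  fromℕ-nonneg (suc n) = +-nonneg 0≤1 (fromℕ-nonneg n)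

  fromℕ-+ : ∀ m n → fromℕ (m ℕ.+ n) ≈ fromℕ m + fromℕ n
  fromℕ-+ = ×-homo-+ 1#

  fromℕ-mono : ∀ {m n} → m ℕ.≤ n → fromℕ m ≤ fromℕ n
  fromℕ-mono {n = n} ℕ.z≤n = fromℕ-nonneg n
  fromℕ-mono (ℕ.s≤s m≤n) = +-monoʳ-≤ 1# (fromℕ-mono m≤n)

  ^-nonneg : 0# ≤ x → ∀ n → 0# ≤ x ^ n
  ^-nonneg 0≤x zero    = 0≤1
  ^-nonneg 0≤x (suc n) = *-nonneg 0≤x (^-nonneg 0≤x n)

  ½ : Carrier
  ½ = recip (fromℕ 2) (fromℕ-pos 2)

  half+half : ∀ x → x * ½ + x * ½ ≈ x
  half+half x = trans
    -- `:1 :+ (:1 :+ :0)` is the unfolding of `fromℕ 2`, written out so that the solver equation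
    -- matches it.
    (solve 2 (λ x h → x :* h :+ x :* h := x :* ((:1 :+ (:1 :+ :0)) :* h)) refl x ½)
    (trans (*-congˡ (*-recipʳ (fromℕ 2) (fromℕ-pos 2))) (*-identityʳ x))

  half-pos : 0# < x → 0# < x * ½
  half-pos 0<x = *-pos 0<x (recip-pos _ _)

  ≤-byε : (∀ ε → 0# < ε → x ≤ y + ε) → x ≤ y
  ≤-byε {x} {y} x≤y+ε y<x = x≤y+ε (δ * ½) (half-pos 0<δ) (<-by
      (trans (solve 3 (λ x y h → x :- (y :+ h) := (x :- y) :- h) refl x y (δ * ½))
        (trans (+-congʳ (sym (half+half δ)))
          (solve 1 (λ h → (h :+ h) :- h := h) refl (δ * ½))))
      (half-pos 0<δ))
    where
    δ : Carrier
    δ = x - y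
    0<δ : 0# < δ
    0<δ = <⇒0< y<x

-- Limits of sequences.

module Limits {c ℓ₁ ℓ₂} (R : RealField c ℓ₁ ℓ₂) where
  open Reals R
  open Order R
  open import Data.Nat.Base as ℕ using (ℕ; _⊔_)
  import Data.Nat.Properties as ℕ
  open import Data.Product.Base using (∃-syntax; _×_; _,_; proj₁; proj₂)
  open import Data.Sum.Base using (inj₁; inj₂)

  Small : Carrier → Carrier → Set ℓ₂
  Small ε x = (x < ε) × (- x < ε)

  Null : (ℕ → Carrier) → Set _
  Null s = ∀ ε → 0# < ε → ∃[ N ] (∀ n → N ℕ.≤ n → Small ε (s n))

  private variable
    s t : ℕ → Carrier
    l m x y δ ε κ : Carrier

  Small-resp : x ≈ y → Small ε x → Small ε y
  Small-resp x≈y (x<ε , -x<ε) = <-respˡ-≈ x≈y x<ε , <-respˡ-≈ (-‿cong x≈y) -x<ε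

  Small-neg : Small ε x → Small ε (- x)
  Small-neg {x = x} (x<ε , -x<ε) =
    -x<ε , <-respˡ-≈ (solve 1 (λ x → x := :- (:- x)) refl x) x<ε

  Small-+ : Small ε x → Small δ y → Small (ε + δ) (x + y)
  Small-+ {x = x} {y = y} (x<ε , -x<ε) (y<δ , -y<δ) =
    +-mono-< x<ε y<δ ,
    <-respˡ-≈ (solve 2 (λ x y → :- x :+ :- y := :- (x :+ y)) refl x y) (+-mono-< -x<ε -y<δ)

  private
    0<x+x⇒0<x : 0# < x + x → 0# < x
    0<x+x⇒0<x {x} 0<x+x with <-cotrans 0<x+x x
    ... | inj₁ 0<x   = 0<x
    ... | inj₂ x<x+x = x<y+x⁻¹ x<x+x

    -- The products (κ - x)(ε + y) and (κ + x)(ε - y) are positive, and in their sum the mixed terms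
    -- cancel, leaving twice κε - xy.
    *-small : Small κ x → Small ε y → x * y < κ * ε
    *-small {κ} {x} {ε} {y} (x<κ , -x<κ) (y<ε , -y<ε) = 0<⇒< (0<x+x⇒0<x (<-respʳ-≈
      (solve 4 (λ κ x ε y → (κ :- x) :* (ε :- :- y) :+ (κ :- :- x) :* (ε :- y)
                         := (κ :* ε :- x :* y) :+ (κ :* ε :- x :* y)) refl κ x ε y)
      (+-pos (*-pos (<⇒0< x<κ) (<⇒0< -y<ε)) (*-pos (<⇒0< -x<κ) (<⇒0< y<ε)))))

  Small-* : Small κ x → Small ε y → Small (κ * ε) (x * y)
  Small-* {x = x} {y = y} x-small y-small = *-small x-small y-small ,
    <-respˡ-≈ (solve 2 (λ x y → x :* (:- y) := :- (x :* y)) refl x y)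
      (*-small x-small (Small-neg y-small))

  bound : ∀ x → ∃[ κ ] (0# < κ × Small κ x)
  bound x with archimedean x | archimedean (- x)
  ... | i , x<i | j , -x<j = 1# + fromℕ (i ℕ.+ j) , ≤-<-trans (fromℕ-nonneg (i ℕ.+ j)) (x<y+x 0<1) ,
    <-trans (<-≤-trans x<i (fromℕ-mono (ℕ.m≤m+n i j))) (x<y+x 0<1) ,
    <-trans (<-≤-trans -x<j (fromℕ-mono (ℕ.m≤n+m j i))) (x<y+x 0<1)

  ⟶⇒Null : s ⟶ l → Null (λ n → s n - l)
  ⟶⇒Null {s} {l} s⟶l ε 0<ε = proj₁ (s⟶l ε 0<ε) , λ n N≤n →
    <-by (solve 3 (λ s l ε → ε :- (s :- l) := (l :+ ε) :- s) refl (s n) l ε)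
      (<⇒0< (proj₁ (proj₂ (s⟶l ε 0<ε) n N≤n))) ,
    <-by (solve 3 (λ s l ε → ε :- (:- (s :- l)) := (s :+ ε) :- l) refl (s n) l ε)
      (<⇒0< (proj₂ (proj₂ (s⟶l ε 0<ε) n N≤n)))

  Null⇒⟶ : Null (λ n → s n - l) → s ⟶ l
  Null⇒⟶ {s} {l} s-l ε 0<ε = proj₁ (s-l ε 0<ε) , λ n N≤n →
    <-by (solve 3 (λ s l ε → (l :+ ε) :- s := ε :- (s :- l)) refl (s n) l ε)
      (<⇒0< (proj₁ (proj₂ (s-l ε 0<ε) n N≤n))) ,
    <-by (solve 3 (λ s l ε → (s :+ ε) :- l := ε :- (:- (s :- l))) refl (s n) l ε)
      (<⇒0< (proj₂ (proj₂ (s-l ε 0<ε) n N≤n)))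

  Null-resp : (∀ n → s n ≈ t n) → Null s → Null t
  Null-resp s≈t s→0 ε 0<ε with s→0 ε 0<ε
  ... | N , small = N , λ n N≤n → Small-resp (s≈t n) (small n N≤n)

  Null-+ : Null s → Null t → Null (λ n → s n + t n)
  Null-+ s→0 t→0 ε 0<ε with s→0 (ε * ½) (half-pos 0<ε) | t→0 (ε * ½) (half-pos 0<ε)
  ... | M , s-small | N , t-small = M ⊔ N , λ n M⊔N≤n → small-resp
    (Small-+ (s-small n (ℕ.m⊔n≤o⇒m≤o M N M⊔N≤n)) (t-small n (ℕ.m⊔n≤o⇒n≤o M N M⊔N≤n)))
    where
    small-resp : ∀ {x} → Small (ε * ½ + ε * ½) x → Small ε x
    small-resp (p , q) = <-respʳ-≈ (half+half ε) p , <-respʳ-≈ (half+half ε) q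

  Null-neg : Null s → Null (λ n → - s n)
  Null-neg s→0 ε 0<ε with s→0 ε 0<ε
  ... | N , small = N , λ n N≤n → Small-neg (small n N≤n)

  EventuallyBounded : (ℕ → Carrier) → Set _
  EventuallyBounded s = ∃[ κ ] (0# < κ × ∃[ N ] (∀ n → N ℕ.≤ n → Small κ (s n)))

  ⟶⇒bounded : s ⟶ l → EventuallyBounded s
  ⟶⇒bounded {s} {l} s⟶l with bound l | ⟶⇒Null s⟶l 1# 0<1
  ... | κ , 0<κ , l-small | N , small = 1# + κ , +-pos 0<1 0<κ , N , λ n N≤n →
    Small-resp (solve 2 (λ s l → (s :- l) :+ l := s) refl (s n) l) (Small-+ (small n N≤n) l-small)

  Null-* : EventuallyBounded s → Null t → Null (λ n → s n * t n)
  Null-* (κ , 0<κ , M , s-small) t→0 ε 0<ε with t→0 (ε / κ ⟨ 0<κ ⟩) (/-pos 0<ε 0<κ)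
  ... | N , t-small = M ⊔ N , λ n M⊔N≤n → small-resp
    (Small-* (s-small n (ℕ.m⊔n≤o⇒m≤o M N M⊔N≤n)) (t-small n (ℕ.m⊔n≤o⇒n≤o M N M⊔N≤n)))
    where
    κ*ε/κ : κ * (ε * recip κ 0<κ) ≈ ε
    κ*ε/κ = trans (solve 3 (λ κ ε r → κ :* (ε :* r) := ε :* (κ :* r)) refl κ ε (recip κ 0<κ))
      (trans (*-congˡ (*-recipʳ κ 0<κ)) (*-identityʳ ε))
    small-resp : ∀ {x} → Small (κ * (ε * recip κ 0<κ)) x → Small ε x
    small-resp (p , q) = <-respʳ-≈ κ*ε/κ p , <-respʳ-≈ κ*ε/κ q

  ⟶-const : ∀ x → (λ _ → x) ⟶ x
  ⟶-const x ε 0<ε = 0 , λ _ _ → x<x+ε , x<x+ε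
    where x<x+ε = <-respʳ-≈ (+-comm ε x) (x<y+x 0<ε)

  ⟶-+ : s ⟶ l → t ⟶ m → (λ n → s n + t n) ⟶ (l + m)
  ⟶-+ {s} {l} {t} {m} s⟶l t⟶m = Null⇒⟶ (Null-resp
    (λ n → solve 4 (λ s l t m → (s :- l) :+ (t :- m) := (s :+ t) :- (l :+ m)) refl (s n) l (t n) m)
    (Null-+ (⟶⇒Null s⟶l) (⟶⇒Null t⟶m)))

  ⟶-neg : s ⟶ l → (λ n → - s n) ⟶ (- l)
  ⟶-neg {s} {l} s⟶l = Null⇒⟶ (Null-resp
    (λ n → solve 2 (λ s l → :- (s :- l) := :- s :- (:- l)) refl (s n) l)
    (Null-neg (⟶⇒Null s⟶l)))

  ⟶-* : s ⟶ l → t ⟶ m → (λ n → s n * t n) ⟶ (l * m)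
  ⟶-* {s} {l} {t} {m} s⟶l t⟶m = Null⇒⟶ (Null-resp
    (λ n → solve 4 (λ s l t m → s :* (t :- m) :+ m :* (s :- l) := s :* t :- l :* m) refl (s n) l (t n) m)
    (Null-+ (Null-* (⟶⇒bounded s⟶l) (⟶⇒Null t⟶m))
            (Null-* (⟶⇒bounded (⟶-const m)) (⟶⇒Null s⟶l))))

  ⟶-mono-≤ : s ⟶ l → t ⟶ m → (∀ n → s n ≤ t n) → l ≤ m
  ⟶-mono-≤ {s} {l} {t} {m} s⟶l t⟶m s≤t = ≤-byε λ ε 0<ε →
    let M , s≈l = s⟶l (ε * ½) (half-pos 0<ε)
        N , t≈m = t⟶m (ε * ½) (half-pos 0<ε)
        n = M ⊔ N
    in <⇒≤ (<-≤-trans (proj₂ (s≈l n (ℕ.m≤m⊔n M N))) (≤-trans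
        (+-mono-≤ (≤-trans (s≤t n) (<⇒≤ (proj₁ (t≈m n (ℕ.m≤n⊔m M N))))) ≤-refl)
        (≤-reflexive (trans (+-assoc m (ε * ½) (ε * ½)) (+-congˡ (half+half ε))))))

  ⟶-subsequence : (φ : ℕ → ℕ) → (∀ n → n ℕ.≤ φ n) → s ⟶ l → (λ n → s (φ n)) ⟶ l
  ⟶-subsequence φ n≤φn s⟶l ε 0<ε with s⟶l ε 0<ε
  ... | N , close = N , λ n N≤n → close (φ n) (ℕ.≤-trans N≤n (n≤φn n))

-- Cauchy products of series and their domination.

module Convolution {c ℓ₁ ℓ₂} (R : RealField c ℓ₁ ℓ₂) where
  open Reals R
  open Order R
  open import Data.Fin.Base using (toℕ)
  open import Data.Nat.Base as ℕ using (ℕ; zero; suc)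
  open import Data.Product.Base using (_×_; _,_)
  open import Function.Base using (_∘_)

  private variable
    x y X Y : Carrier

  infix 4 _≼_
  -- This is |x| ≤ X, expressed without constructing an absolute value.
  _≼_ : Carrier → Carrier → Set ℓ₂
  x ≼ X = (x ≤ X) × (- x ≤ X)

  ≼-resp : x ≈ y → X ≈ Y → x ≼ X → y ≼ Y
  ≼-resp x≈y X≈Y (x≤X , -x≤X) =
    ≤-trans (≤-reflexive (sym x≈y)) (≤-trans x≤X (≤-reflexive X≈Y)) ,
    ≤-trans (≤-reflexive (-‿cong (sym x≈y))) (≤-trans -x≤X (≤-reflexive X≈Y))

  ≼-+ : x ≼ X → y ≼ Y → x + y ≼ X + Y
  ≼-+ {x} {X} {y} {Y} (x≤X , -x≤X) (y≤Y , -y≤Y) = +-mono-≤ x≤X y≤Y ,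
    ≤-trans (≤-reflexive (solve 2 (λ x y → :- (x :+ y) := :- x :+ :- y) refl x y)) (+-mono-≤ -x≤X -y≤Y)

  private
    0≤x+x⇒0≤x : 0# ≤ x + x → 0# ≤ x
    0≤x+x⇒0≤x 0≤x+x x<0 = 0≤x+x (<-respʳ-≈ (+-identityˡ 0#) (+-mono-< x<0 x<0))

    *-≼ : x ≼ X → y ≼ Y → x * y ≤ X * Y
    *-≼ {x} {X} {y} {Y} (x≤X , -x≤X) (y≤Y , -y≤Y) = 0≤⇒≤ (0≤x+x⇒0≤x (≤-trans
      (+-nonneg (*-nonneg (≤⇒0≤ x≤X) (≤⇒0≤ -y≤Y)) (*-nonneg (≤⇒0≤ -x≤X) (≤⇒0≤ y≤Y)))
      (≤-reflexive (solve 4 (λ X x Y y → (X :- x) :* (Y :- :- y) :+ (X :- :- x) :* (Y :- y)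
        := (X :* Y :- x :* y) :+ (X :* Y :- x :* y)) refl X x Y y))))

  ≼-neg : x ≼ X → - x ≼ X
  ≼-neg {x} (x≤X , -x≤X) =
    -x≤X , ≤-trans (≤-reflexive (solve 1 (λ x → :- (:- x) := x) refl x)) x≤X

  ≼-* : x ≼ X → y ≼ Y → x * y ≼ X * Y
  ≼-* {x} {X} {y} {Y} x≼X y≼Y = *-≼ x≼X y≼Y ,
    ≤-trans (≤-reflexive (solve 2 (λ x y → :- (x :* y) := x :* (:- y)) refl x y)) (*-≼ x≼X (≼-neg y≼Y))

  nonneg⇒≼ : 0# ≤ x → x ≼ x
  nonneg⇒≼ {x} 0≤x = ≤-refl , ≤-by (solve 1 (λ x → x :- (:- x) := x :+ x) refl x) (+-nonneg 0≤x 0≤x)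

  Σ : ℕ → (ℕ → Carrier) → Carrier
  Σ n f = sum {n} (λ k → f (toℕ k))

  Σ-cong : ∀ n {f g} → (∀ k → f k ≈ g k) → Σ n f ≈ Σ n g
  Σ-cong zero    f≈g = refl
  Σ-cong (suc n) f≈g = +-cong (f≈g 0) (Σ-cong n (f≈g ∘ suc))

  Σ-mono : ∀ n {f g} → (∀ k → f k ≤ g k) → Σ n f ≤ Σ n g
  Σ-mono zero    f≤g = ≤-refl
  Σ-mono (suc n) f≤g = +-mono-≤ (f≤g 0) (Σ-mono n (f≤g ∘ suc))

  Σ-nonneg : ∀ n {f} → (∀ k → 0# ≤ f k) → 0# ≤ Σ n f
  Σ-nonneg zero    0≤f = ≤-refl
  Σ-nonneg (suc n) 0≤f = +-nonneg (0≤f 0) (Σ-nonneg n (0≤f ∘ suc))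

  Σ-monoˡ : ∀ {m n f} → (∀ k → 0# ≤ f k) → m ℕ.≤ n → Σ m f ≤ Σ n f
  Σ-monoˡ {n = n} 0≤f ℕ.z≤n = Σ-nonneg n 0≤f
  Σ-monoˡ 0≤f (ℕ.s≤s m≤n)   = +-monoʳ-≤ _ (Σ-monoˡ (0≤f ∘ suc) m≤n)

  Σ-affine : ∀ n a f g → Σ n (λ k → a * f k + g k) ≈ a * Σ n f + Σ n g
  Σ-affine zero    a f g = solve 1 (λ a → :0 := a :* :0 :+ :0) refl a
  Σ-affine (suc n) a f g = trans (+-congˡ (Σ-affine n a (f ∘ suc) (g ∘ suc)))
    (solve 5 (λ a f g F G → (a :* f :+ g) :+ (a :* F :+ G) := a :* (f :+ F) :+ (g :+ G))
      refl a (f 0) (g 0) (Σ n (f ∘ suc)) (Σ n (g ∘ suc)))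

  -- The coefficients of the product of two formal power series.
  conv : (f g : ℕ → Carrier) → ℕ → Carrier
  conv f g zero    = f 0 * g 0
  conv f g (suc n) = f 0 * g (suc n) + conv (f ∘ suc) g n

  -- The sum of f i * g j over i + j < n.
  triangle : (f g : ℕ → Carrier) → ℕ → Carrier
  triangle f g zero    = 0#
  triangle f g (suc n) = f 0 * Σ (suc n) g + triangle (f ∘ suc) g n

  Σ-conv : ∀ n f g → Σ n (conv f g) ≈ triangle f g n
  Σ-conv zero    f g = refl
  Σ-conv (suc n) f g = trans
    (+-congˡ (trans (Σ-affine n (f 0) (g ∘ suc) (conv (f ∘ suc) g)) (+-congˡ (Σ-conv n (f ∘ suc) g))))
    (solve 4 (λ f g G T → f :* g :+ (f :* G :+ T) := f :* (g :+ G) :+ T)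
      refl (f 0) (g 0) (Σ n (g ∘ suc)) (triangle (f ∘ suc) g n))

  Σ-tail-≼ : ∀ {m n} {g G : ℕ → Carrier} → (∀ k → g k ≼ G k) → m ℕ.≤ n → Σ n g - Σ m g ≼ Σ n G - Σ m G
  Σ-tail-≼ {n = zero}  g≼G ℕ.z≤n = nonneg⇒≼ (≤-reflexive (solve 0 (:0 := :0 :- :0) refl))
  Σ-tail-≼ {n = suc n} {g} {G} g≼G ℕ.z≤n = ≼-resp (assoc g) (assoc G)
    (≼-+ (g≼G 0) (Σ-tail-≼ {n = n} (g≼G ∘ suc) ℕ.z≤n))
    where
    assoc : ∀ h → h 0 + (Σ n (h ∘ suc) - 0#) ≈ (h 0 + Σ n (h ∘ suc)) - 0#
    assoc h = sym (+-assoc _ _ _)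
  Σ-tail-≼ {suc m} {suc n} {g} {G} g≼G (ℕ.s≤s m≤n) = ≼-resp (cancel g) (cancel G) (Σ-tail-≼ (g≼G ∘ suc) m≤n)
    where
    cancel : ∀ h → Σ n (h ∘ suc) - Σ m (h ∘ suc) ≈ Σ (suc n) h - Σ (suc m) h
    cancel h = solve 3 (λ h a b → a :- b := (h :+ a) :- (h :+ b)) refl (h 0) (Σ n (h ∘ suc)) (Σ m (h ∘ suc))

  -- The difference is the sum of f i * g j over the pairs of the rectangle with i + j ≥ m. In each
  -- row these form a tail of the sum of g, so domination holds term by term.
  rectangle-triangle-≼ : ∀ {m n} {f g F G : ℕ → Carrier} →
    (∀ k → f k ≼ F k) → (∀ k → g k ≼ G k) → m ℕ.≤ n →
    Σ m f * Σ n g - triangle f g m ≼ Σ m F * Σ n G - triangle F G m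
  rectangle-triangle-≼ {zero} {n} {f} {g} {F} {G} f≼F g≼G _ = ≼-resp (zero-zero g) (zero-zero G) (nonneg⇒≼ ≤-refl)
    where
    zero-zero : ∀ h → 0# ≈ 0# * Σ n h - 0#
    zero-zero h = solve 1 (λ x → :0 := :0 :* x :- :0) refl (Σ n h)
  rectangle-triangle-≼ {suc m} {n} {f} {g} {F} {G} f≼F g≼G m<n = ≼-resp (split f g) (split F G)
    (≼-+ (≼-* (f≼F 0) (Σ-tail-≼ g≼G m<n)) (rectangle-triangle-≼ (f≼F ∘ suc) g≼G (ℕ.<⇒≤ m<n)))
    where
    import Data.Nat.Properties as ℕ
    split : ∀ f g → f 0 * (Σ n g - Σ (suc m) g) + (Σ m (f ∘ suc) * Σ n g - triangle (f ∘ suc) g m)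
      ≈ Σ (suc m) f * Σ n g - triangle f g (suc m)
    split f g = solve 5 (λ f F G G' T → f :* (G :- G') :+ (F :* G :- T) := (f :+ F) :* G :- (f :* G' :+ T))
      refl (f 0) (Σ m (f ∘ suc)) (Σ n g) (Σ (suc m) g) (triangle (f ∘ suc) g m)

  triangle-nonneg : ∀ n {F G} → (∀ k → 0# ≤ F k) → (∀ k → 0# ≤ G k) → 0# ≤ triangle F G n
  triangle-nonneg zero    0≤F 0≤G = ≤-refl
  triangle-nonneg (suc n) 0≤F 0≤G =
    +-nonneg (*-nonneg (0≤F 0) (Σ-nonneg (suc n) 0≤G)) (triangle-nonneg n (0≤F ∘ suc) 0≤G)

  rectangle≤triangle : ∀ m n {F G} → (∀ k → 0# ≤ F k) → (∀ k → 0# ≤ G k) →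
    Σ m F * Σ n G ≤ triangle F G (m ℕ.+ n)
  rectangle≤triangle zero    n 0≤F 0≤G =
    ≤-trans (≤-reflexive (zeroˡ _)) (triangle-nonneg n 0≤F 0≤G)
  rectangle≤triangle (suc m) n {F} {G} 0≤F 0≤G = ≤-trans (≤-reflexive (distribʳ _ _ _))
    (+-mono-≤ (*-monoʳ-≤ (0≤F 0) (Σ-monoˡ 0≤G (ℕ.m≤n+m n (suc m))))
              (rectangle≤triangle m n (0≤F ∘ suc) 0≤G))
    where import Data.Nat.Properties as ℕ

  conv-+ : ∀ n {f h k} g → (∀ i → f i ≈ h i + k i) → conv f g n ≈ conv h g n + conv k g n
  conv-+ zero    g f≈ = trans (*-congʳ (f≈ 0)) (distribʳ _ _ _)
  conv-+ (suc n) {f} {h} {k} g f≈ = trans (+-cong (*-congʳ (f≈ 0)) (conv-+ n g (f≈ ∘ suc)))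
    (solve 5 (λ h k g H K → (h :+ k) :* g :+ (H :+ K) := (h :* g :+ H) :+ (k :* g :+ K))
      refl (h 0) (k 0) (g (suc n)) (conv (h ∘ suc) g n) (conv (k ∘ suc) g n))

  conv-scaleˡ : ∀ n a {f h} g → (∀ i → f i ≈ a * h i) → conv f g n ≈ a * conv h g n
  conv-scaleˡ zero    a g f≈ = trans (*-congʳ (f≈ 0)) (*-assoc _ _ _)
  conv-scaleˡ (suc n) a {f} {h} g f≈ = trans (+-cong (*-congʳ (f≈ 0)) (conv-scaleˡ n a g (f≈ ∘ suc)))
    (solve 4 (λ a h g H → a :* h :* g :+ a :* H := a :* (h :* g :+ H))
      refl a (h 0) (g (suc n)) (conv (h ∘ suc) g n))

  conv-scaleʳ : ∀ n a f {g h} → (∀ i → g i ≈ a * h i) → conv f g n ≈ a * conv f h n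
  conv-scaleʳ zero    a f {g} {h} g≈ = trans (*-congˡ (g≈ 0))
    (solve 3 (λ a f h → f :* (a :* h) := a :* (f :* h)) refl a (f 0) (h 0))
  conv-scaleʳ (suc n) a f {g} {h} g≈ = trans (+-cong (*-congˡ (g≈ (suc n))) (conv-scaleʳ n a (f ∘ suc) g≈))
    (solve 4 (λ a f h H → f :* (a :* h) :+ a :* H := a :* (f :* h :+ H))
      refl a (f 0) (h (suc n)) (conv (f ∘ suc) h n))

  -- The formal derivative, acting on coefficients.
  ∂ : (ℕ → Carrier) → ℕ → Carrier
  ∂ f i = fromℕ (suc i) * f (suc i)

  -- The product rule for formal power series; in `conv-expTerm` it takes the place of the binomial
  -- theorem.
  leibniz : ∀ n f g → ∂ (conv f g) n ≈ conv (∂ f) g n + conv f (∂ g) n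
  leibniz zero f g = solve 4
    (λ f₀ f₁ g₀ g₁ → (:1 :+ :0) :* (f₀ :* g₁ :+ f₁ :* g₀)
      := (:1 :+ :0) :* f₁ :* g₀ :+ f₀ :* ((:1 :+ :0) :* g₁)) refl (f 0) (f 1) (g 0) (g 1)
  leibniz (suc n) f g = begin
    (1# + a) * (f 0 * g (suc (suc n)) + conv f′ g (suc n))
      ≈⟨ solve 4 (λ a f g C → (:1 :+ a) :* (f :* g :+ C) := f :* ((:1 :+ a) :* g) :+ C :+ a :* C)
           refl a (f 0) (g (suc (suc n))) (conv f′ g (suc n)) ⟩
    f 0 * ∂ g (suc n) + conv f′ g (suc n) + a * conv f′ g (suc n)
      ≈⟨ +-congˡ (leibniz n f′ g) ⟩
    f 0 * ∂ g (suc n) + (f 1 * g (suc n) + conv f″ g n) + (conv (∂ f′) g n + conv f′ (∂ g) n)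
      ≈⟨ solve 6 (λ A f g B C D → A :+ (f :* g :+ B) :+ (C :+ D)
           := (((:1 :+ :0) :* f) :* g :+ (B :+ C)) :+ (A :+ D))
           refl (f 0 * ∂ g (suc n)) (f 1) (g (suc n)) (conv f″ g n) (conv (∂ f′) g n) (conv f′ (∂ g) n) ⟩
    (∂ f 0 * g (suc n) + (conv f″ g n + conv (∂ f′) g n)) + conv f (∂ g) (suc n)
      ≈⟨ +-congʳ (+-congˡ (sym (conv-+ n g λ i → solve 2 (λ b h → (:1 :+ b) :* h := h :+ b :* h)
           refl (fromℕ (suc i)) (f (suc (suc i)))))) ⟩
    conv (∂ f) g (suc n) + conv f (∂ g) (suc n) ∎
    where
    open import Relation.Binary.Reasoning.Setoid setoid
    a : Carrier
    a = fromℕ (suc n)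
    f′ f″ : ℕ → Carrier
    f′ = f ∘ suc
    f″ = f′ ∘ suc

-- The exponential function, from its power series.

module Exponential {c ℓ₁ ℓ₂} (R : RealField c ℓ₁ ℓ₂) (EL : ExpLog R) where
  open Reals R
  open ExpLog EL
  open Order R
  open Limits R
  open Convolution R
  open import Algebra.Properties.Semiring.Exp semiring using (^-congˡ)
  open import Algebra.Properties.Semiring.Mult semiring using (×1-homo-*)
  open import Data.Nat.Base as ℕ using (ℕ; zero; suc; _!)
  import Data.Nat.Properties as ℕ
  open import Data.Product.Base using (_,_; proj₁; proj₂)
  open import Function.Base using (_∘_)

  private variable
    x y a : Carrier

  private
    0<_! : ∀ k → 0# < fromℕ (k !)
    0< k ! = fromℕ-pos (k !) {{k ℕ.!≢0}}

  ∂-expTerm : ∀ x k → ∂ (expTerm x) k ≈ x * expTerm x k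
  ∂-expTerm x k = begin
    b * (x * x ^ k * r′)     ≈⟨ solve 4 (λ b x y r → b :* (x :* y :* r) := x :* (y :* (b :* r))) refl b x (x ^ k) r′ ⟩
    x * (x ^ k * (b * r′))   ≈⟨ *-congˡ (*-congˡ (*-cancelˡ-≈ (0< k !) k!br′≈k!r)) ⟩
    x * (x ^ k * r)          ∎
    where
    open import Relation.Binary.Reasoning.Setoid setoid
    b r r′ : Carrier
    b  = fromℕ (suc k)
    r  = recip (fromℕ (k !)) (0< k !)
    r′ = recip (fromℕ (suc k !)) (0< suc k !)
    k!br′≈k!r : fromℕ (k !) * (b * r′) ≈ fromℕ (k !) * r
    k!br′≈k!r = begin
      fromℕ (k !) * (b * r′)     ≈⟨ solve 3 (λ f b r → f :* (b :* r) := b :* f :* r) refl (fromℕ (k !)) b r′ ⟩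
      b * fromℕ (k !) * r′       ≈⟨ *-congʳ (×1-homo-* (suc k) (k !)) ⟨
      fromℕ (suc k !) * r′       ≈⟨ *-recipʳ _ _ ⟩
      1#                         ≈⟨ *-recipʳ _ _ ⟨
      fromℕ (k !) * r            ∎

  expTerm-zero : ∀ x → expTerm x 0 ≈ 1#
  expTerm-zero x = trans (*-congʳ (sym (+-identityʳ 1#))) (*-recipʳ _ (0< 0 !))

  -- As coefficient sequences, both sides solve F' = (x + y) F with constant term 1. Each
  -- coefficient is therefore determined by its predecessor once the factor k + 1 is cancelled.
  conv-expTerm : ∀ x y k → conv (expTerm x) (expTerm y) k ≈ expTerm (x + y) k
  conv-expTerm x y zero = trans (*-cong (expTerm-zero x) (expTerm-zero y))
    (trans (*-identityˡ 1#) (sym (expTerm-zero (x + y))))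
  conv-expTerm x y (suc k) = *-cancelˡ-≈ (fromℕ-pos (suc k)) (begin
    ∂ (conv (expTerm x) (expTerm y)) k
      ≈⟨ leibniz k (expTerm x) (expTerm y) ⟩
    conv (∂ (expTerm x)) (expTerm y) k + conv (expTerm x) (∂ (expTerm y)) k
      ≈⟨ +-cong (conv-scaleˡ k x (expTerm y) (∂-expTerm x)) (conv-scaleʳ k y (expTerm x) (∂-expTerm y)) ⟩
    x * conv (expTerm x) (expTerm y) k + y * conv (expTerm x) (expTerm y) k
      ≈⟨ distribʳ _ x y ⟨
    (x + y) * conv (expTerm x) (expTerm y) k
      ≈⟨ *-congˡ (conv-expTerm x y k) ⟩
    (x + y) * expTerm (x + y) k
      ≈⟨ ∂-expTerm (x + y) k ⟨
    ∂ (expTerm (x + y)) k ∎)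
    where open import Relation.Binary.Reasoning.Setoid setoid

  Σ-expTerm-+ : ∀ x y n → expPartialSum (x + y) n ≈ triangle (expTerm x) (expTerm y) n
  Σ-expTerm-+ x y n = trans (Σ-cong n λ k → sym (conv-expTerm x y k)) (Σ-conv n _ _)

  private
    recip-nonneg : ∀ k → 0# ≤ recip (fromℕ (k !)) (0< k !)
    recip-nonneg k = <⇒≤ (recip-pos _ _)

  expTerm-nonneg : 0# ≤ x → ∀ k → 0# ≤ expTerm x k
  expTerm-nonneg 0≤x k = *-nonneg (^-nonneg 0≤x k) (recip-nonneg k)

  ^-≼ : x ≼ a → ∀ k → x ^ k ≼ a ^ k
  ^-≼ x≼a zero    = nonneg⇒≼ 0≤1
  ^-≼ x≼a (suc k) = ≼-* x≼a (^-≼ x≼a k)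

  expTerm-≼ : x ≼ a → ∀ k → expTerm x k ≼ expTerm a k
  expTerm-≼ x≼a k = ≼-* (^-≼ x≼a k) (nonneg⇒≼ (recip-nonneg k))

  -- For ∣x∣, ∣y∣ ≤ a the difference between the product of the partial sums
  -- and the partial sum at x + y is dominated by the same difference at a, a,
  -- whose limit is ≤ 0 because rectangles lie in larger triangles.

  exp-+ : ∀ x y → exp (x + y) ≈ exp x * exp y
  exp-+ x y = sym (≤-antisym
    (≤-by (solve 2 (λ u v → v :- u := :0 :- (u :- v)) refl _ _)
      (≤⇒0≤ (≤-trans (⟶-mono-≤ (gap⟶ x y) (gap⟶ b b) (proj₁ ∘ gap-≼)) gap-b≤0)))
    (≤-by (solve 2 (λ u v → u :- v := :0 :- (:- (u :- v))) refl _ _)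
      (≤⇒0≤ (≤-trans (⟶-mono-≤ (⟶-neg (gap⟶ x y)) (gap⟶ b b) (proj₂ ∘ gap-≼)) gap-b≤0))))
    where
    S : Carrier → ℕ → Carrier
    S = expPartialSum
    gap⟶ : ∀ u v → (λ n → S u n * S v n - S (u + v) n) ⟶ (exp u * exp v - exp (u + v))
    gap⟶ u v = ⟶-+ (⟶-* (exp-series u) (exp-series v)) (⟶-neg (exp-series (u + v)))
    b : Carrier
    b = proj₁ (bound x) + proj₁ (bound y)
    0≤κ : ∀ z → 0# ≤ proj₁ (bound z)
    0≤κ z = <⇒≤ (proj₁ (proj₂ (bound z)))
    z≼κ : ∀ z → z ≼ proj₁ (bound z)
    z≼κ z = <⇒≤ (proj₁ (proj₂ (proj₂ (bound z)))) , <⇒≤ (proj₂ (proj₂ (proj₂ (bound z))))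
    0≼ : ∀ {z} → 0# ≤ z → 0# ≼ z
    0≼ 0≤z = 0≤z , ≤-trans (≤-reflexive (solve 0 (:- :0 := :0) refl)) 0≤z
    0≤b : 0# ≤ b
    0≤b = +-nonneg (0≤κ x) (0≤κ y)
    x≼b : x ≼ b
    x≼b = ≼-resp (+-identityʳ x) refl (≼-+ (z≼κ x) (0≼ (0≤κ y)))
    y≼b : y ≼ b
    y≼b = ≼-resp (+-identityˡ y) refl (≼-+ (0≼ (0≤κ x)) (z≼κ y))
    gap-triangle : ∀ u v n → S u n * S v n - triangle (expTerm u) (expTerm v) n ≈ S u n * S v n - S (u + v) n
    gap-triangle u v n = +-congˡ (-‿cong (sym (Σ-expTerm-+ u v n)))
    gap-≼ : ∀ n → S x n * S y n - S (x + y) n ≼ S b n * S b n - S (b + b) n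
    gap-≼ n = ≼-resp (gap-triangle x y n) (gap-triangle b b n)
      (rectangle-triangle-≼ {n} {n} (expTerm-≼ x≼b) (expTerm-≼ y≼b) ℕ.≤-refl)
    gap-b≤0 : exp b * exp b - exp (b + b) ≤ 0#
    gap-b≤0 = ≤-by (solve 2 (λ u v → :0 :- (u :- v) := v :- u) refl _ _) (≤⇒0≤
      (⟶-mono-≤ (⟶-* (exp-series b) (exp-series b))
        (⟶-subsequence (λ n → n ℕ.+ n) (λ n → ℕ.m≤m+n n n) (exp-series (b + b)))
        λ n → ≤-trans (rectangle≤triangle n n (expTerm-nonneg 0≤b) (expTerm-nonneg 0≤b))
                      (≤-reflexive (sym (Σ-expTerm-+ b b (n ℕ.+ n))))))

  -- `exp` comes as a bare function on a setoid; it respects `_≈_` because equal partial sums force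
  -- equal limits.
  exp-cong : x ≈ y → exp x ≈ exp y
  exp-cong {x} {y} x≈y = ≤-antisym (half x≈y) (half (sym x≈y))
    where
    half : ∀ {x y} → x ≈ y → exp x ≤ exp y
    half {x} {y} x≈y = ⟶-mono-≤ (exp-series x) (exp-series y)
      λ n → ≤-reflexive (Σ-cong n {expTerm x} {expTerm y} λ k → *-congʳ (^-congˡ k x≈y))

  private
    expTerm-one : ∀ x → expTerm x 1 ≈ x
    expTerm-one x = trans (solve 1 (λ t → t := (:1 :+ :0) :* t) refl (expTerm x 1))
      (trans (∂-expTerm x 0) (trans (*-congˡ (expTerm-zero x)) (*-identityʳ x)))

    1+x≤exp-nonneg : 0# ≤ x → 1# + x ≤ exp x
    1+x≤exp-nonneg {x} 0≤x = ⟶-mono-≤ (⟶-const (1# + x))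
      (⟶-subsequence (2 ℕ.+_) (λ n → ℕ.m≤n+m n 2) (exp-series x)) λ n → ≤-trans
        (≤-reflexive (+-cong (sym (expTerm-zero x)) (sym (expTerm-one x))))
        (≤-by (solve 3 (λ u v s → (u :+ (v :+ s)) :- (u :+ v) := s) refl (expTerm x 0) (expTerm x 1) _)
          (Σ-nonneg n {λ k → expTerm x (suc (suc k))} (λ k → expTerm-nonneg 0≤x (2 ℕ.+ k))))

    expTerm-suc-≤ : 0# ≤ x → ∀ k → expTerm x (suc k) ≤ x * expTerm x k
    expTerm-suc-≤ {x} 0≤x k = ≤-trans (≤-by
      (solve 2 (λ b t → (:1 :+ b) :* t :- t := b :* t) refl (fromℕ k) (expTerm x (suc k)))
      (*-nonneg (fromℕ-nonneg k) (expTerm-nonneg 0≤x (suc k))))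
      (≤-reflexive (∂-expTerm x k))

    -- Rearranged, this is (1 - x) exp x ≤ 1, the bound 1 + t ≤ exp t at t = - x. The terms of the
    -- series satisfy (k + 1) t_{k+1} = x t_k, so t_{k+1} ≤ x t_k.
    exp≤1+x*exp : 0# ≤ x → exp x ≤ 1# + x * exp x
    -- One more term is taken on the left, since the constant term is split off there.
    exp≤1+x*exp {x} 0≤x = ⟶-mono-≤ (⟶-subsequence suc ℕ.n≤1+n (exp-series x))
      (⟶-+ (⟶-const 1#) (⟶-* (⟶-const x) (exp-series x))) λ n → +-mono-≤
        (≤-reflexive (expTerm-zero x))
        (≤-trans (Σ-mono n {expTerm x ∘ suc} {λ k → x * expTerm x k + 0#}
            (λ k → ≤-trans (expTerm-suc-≤ 0≤x k) (≤-reflexive (sym (+-identityʳ _)))))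
          (≤-reflexive (trans (Σ-affine n x (expTerm x) (λ _ → 0#)) (trans (+-congˡ (Σ-0 n)) (+-identityʳ _)))))
      where
      Σ-0 : ∀ n → Σ n (λ _ → 0#) ≈ 0#
      Σ-0 zero    = refl
      Σ-0 (suc n) = trans (+-identityˡ _) (Σ-0 n)

  exp-zero : exp 0# ≈ 1#
  exp-zero = ≤-antisym
    (≤-trans (exp≤1+x*exp ≤-refl) (≤-reflexive (solve 1 (λ E → :1 :+ :0 :* E := :1) refl _)))
    (≤-trans (≤-reflexive (sym (+-identityʳ 1#))) (1+x≤exp-nonneg ≤-refl))

  exp-neg : ∀ x → exp x * exp (- x) ≈ 1#
  exp-neg x = trans (sym (exp-+ x (- x))) (trans (exp-cong (-‿inverseʳ x)) exp-zero)

  exp-nonneg : ∀ x → 0# ≤ exp x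
  exp-nonneg x = ≤-trans (square-nonneg (exp (x * ½)))
    (≤-reflexive (trans (sym (exp-+ (x * ½) (x * ½))) (exp-cong (half+half x))))

  1+x≤exp : ∀ x → 1# + x ≤ exp x
  1+x≤exp x = ≤-byTotality 0# x 1+x≤exp-nonneg λ x≤0 → begin
    1# + x                                   ≈⟨ *-identityʳ _ ⟨
    (1# + x) * 1#                            ≈⟨ *-congˡ (exp-neg x) ⟨
    (1# + x) * (exp x * exp (- x))           ≈⟨ solve 3 (λ x e f → (:1 :+ x) :* (e :* f) := (f :- (:- x) :* f) :* e)
                                                  refl x (exp x) (exp (- x)) ⟩
    (exp (- x) - - x * exp (- x)) * exp x    ≤⟨ *-monoˡ-≤ (exp-nonneg x) (≤-by
        (solve 2 (λ f g → :1 :- (f :- g) := (:1 :+ g) :- f) refl (exp (- x)) (- x * exp (- x)))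
        (≤⇒0≤ (exp≤1+x*exp (≤-trans (≤⇒0≤ x≤0) (≤-reflexive (+-identityˡ _)))))) ⟩
    1# * exp x                               ≈⟨ *-identityˡ _ ⟩
    exp x                                    ∎
    where open ≤-Reasoning

  1≤exp : 0# ≤ x → 1# ≤ exp x
  1≤exp {x} 0≤x = ≤-trans (≤-by (solve 1 (λ x → (:1 :+ x) :- :1 := x) refl x) 0≤x) (1+x≤exp x)

  exp-mono : x ≤ y → exp x ≤ exp y
  exp-mono {x} {y} x≤y = begin
    exp x                  ≈⟨ *-identityʳ _ ⟨
    exp x * 1#             ≤⟨ *-monoʳ-≤ (exp-nonneg x) (1≤exp (≤⇒0≤ x≤y)) ⟩
    exp x * exp (y - x)    ≈⟨ exp-+ x (y - x) ⟨
    exp (x + (y - x))      ≈⟨ exp-cong (solve 2 (λ x y → x :+ (y :- x) := y) refl x y) ⟩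
    exp y                  ∎
    where open ≤-Reasoning

-- Indicators and finite sums.

module Sums {c ℓ₁ ℓ₂} (R : RealField c ℓ₁ ℓ₂) where
  open Reals R
  open Weights R
  open Order R
  open import Data.Bool.Base using (if_then_else_)
  open import Data.Empty using (⊥-elim)
  open import Data.List.Base using (List; []; _∷_; _++_; map; filter)
  open import Function.Base using (_∘_)
  open import Level using (Level)
  open import Relation.Nullary.Decidable using (Dec; yes; no; does)
  open import Relation.Unary using (Pred; Decidable)

  private variable
    a b : Level
    X Y : Set a
    P Q S : Set b

  𝟙 : Dec P → Carrier
  𝟙 P? = if does P? then 1# else 0#

  𝟙-nonneg : (P? : Dec P) → 0# ≤ 𝟙 P?
  𝟙-nonneg (yes _) = 0≤1
  𝟙-nonneg (no _)  = ≤-refl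

  𝟙≤1 : (P? : Dec P) → 𝟙 P? ≤ 1#
  𝟙≤1 (yes _) = ≤-refl
  𝟙≤1 (no _)  = 0≤1

  𝟙-mono : (P? : Dec P) (Q? : Dec Q) → (P → Q) → 𝟙 P? ≤ 𝟙 Q?
  𝟙-mono (yes p) (yes q) _   = ≤-refl
  𝟙-mono (yes p) (no ¬q) P⇒Q = ⊥-elim (¬q (P⇒Q p))
  𝟙-mono (no ¬p) Q?      _   = 𝟙-nonneg Q?

  𝟙-× : (P? : Dec P) (Q? : Dec Q) (S? : Dec S) → (P → Q → S) → (S → P) → (S → Q) → 𝟙 P? * 𝟙 Q? ≈ 𝟙 S?
  𝟙-× (yes p) (yes q) (yes s) _ _ _ = *-identityˡ _
  𝟙-× (yes p) (yes q) (no ¬s) f _ _ = ⊥-elim (¬s (f p q))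
  𝟙-× (yes p) (no ¬q) (yes s) _ _ h = ⊥-elim (¬q (h s))
  𝟙-× (yes p) (no ¬q) (no ¬s) _ _ _ = *-identityˡ _
  𝟙-× (no ¬p) _       (yes s) _ g _ = ⊥-elim (¬p (g s))
  𝟙-× (no ¬p) _       (no ¬s) _ _ _ = zeroˡ _

  sumOver-cong : ∀ (xs : List X) {f g} → (∀ x → f x ≈ g x) → sumOver xs f ≈ sumOver xs g
  sumOver-cong []       f≈g = refl
  sumOver-cong (x ∷ xs) f≈g = +-cong (f≈g x) (sumOver-cong xs f≈g)

  sumOver-mono : ∀ (xs : List X) {f g} → (∀ x → f x ≤ g x) → sumOver xs f ≤ sumOver xs g
  sumOver-mono []       f≤g = ≤-refl
  sumOver-mono (x ∷ xs) f≤g = +-mono-≤ (f≤g x) (sumOver-mono xs f≤g)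

  sumOver-nonneg : ∀ (xs : List X) {f} → (∀ x → 0# ≤ f x) → 0# ≤ sumOver xs f
  sumOver-nonneg []       0≤f = ≤-refl
  sumOver-nonneg (x ∷ xs) 0≤f = +-nonneg (0≤f x) (sumOver-nonneg xs 0≤f)

  sumOver-+ : ∀ (xs : List X) f g → sumOver xs (λ x → f x + g x) ≈ sumOver xs f + sumOver xs g
  sumOver-+ []       f g = sym (+-identityˡ 0#)
  sumOver-+ (x ∷ xs) f g = trans (+-congˡ (sumOver-+ xs f g))
    (solve 4 (λ a b c d → (a :+ b) :+ (c :+ d) := (a :+ c) :+ (b :+ d)) refl _ _ _ _)

  sumOver-*ˡ : ∀ a (xs : List X) f → sumOver xs (λ x → a * f x) ≈ a * sumOver xs f
  sumOver-*ˡ a []       f = sym (zeroʳ a)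
  sumOver-*ˡ a (x ∷ xs) f = trans (+-congˡ (sumOver-*ˡ a xs f)) (sym (distribˡ a _ _))

  sumOver-*ʳ : ∀ a (xs : List X) f → sumOver xs (λ x → f x * a) ≈ sumOver xs f * a
  sumOver-*ʳ a xs f = trans (sumOver-cong xs λ x → *-comm (f x) a)
    (trans (sumOver-*ˡ a xs f) (*-comm a _))

  sumOver-++ : ∀ (xs ys : List X) f → sumOver (xs ++ ys) f ≈ sumOver xs f + sumOver ys f
  sumOver-++ []       ys f = sym (+-identityˡ _)
  sumOver-++ (x ∷ xs) ys f = trans (+-congˡ (sumOver-++ xs ys f)) (sym (+-assoc _ _ _))

  sumOver-map : ∀ (h : X → Y) xs f → sumOver (map h xs) f ≈ sumOver xs (f ∘ h)
  sumOver-map h []       f = refl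
  sumOver-map h (x ∷ xs) f = +-congˡ (sumOver-map h xs f)

  sumOver-filter : ∀ {ℓ} {P : Pred X ℓ} (P? : Decidable P) xs f →
    sumOver (filter P? xs) f ≈ sumOver xs (λ x → 𝟙 (P? x) * f x)
  sumOver-filter P? []       f = refl
  sumOver-filter P? (x ∷ xs) f with P? x
  ... | yes _ = +-cong (sym (*-identityˡ _)) (sumOver-filter P? xs f)
  ... | no _  = trans (sumOver-filter P? xs f) (trans (sym (+-identityˡ _)) (+-congʳ (sym (zeroˡ _))))

-- Expectation over the random subset, and Janson's inequality.

module Probability {c ℓ₁ ℓ₂} (R : RealField c ℓ₁ ℓ₂) (p : RealField.Carrier R)
  (0≤p : RealField._≤_ R (RealField.0# R) p) (p≤1 : RealField._≤_ R p (RealField.1# R)) where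
  open Reals R
  open Weights R
  open Order R
  open Sums R
  open import Data.Empty using (⊥-elim)
  open import Data.Fin.Subset using (Subset; inside; outside; Nonempty; _∪_; _∩_; ∣_∣)
  open import Data.Fin.Subset.Properties
    using (_⊆?_; nonempty?; p⊆p∪q; q⊆p∪q; x∈p∪q⁻; x∈p∩q⁺)
  open import Data.List.Base using (List; []; _∷_; map; filter)
  open import Data.List.Relation.Unary.All using (All; []; _∷_)
  open import Data.List.Relation.Unary.All.Properties using (all-filter)
  open import Data.Nat.Base using (zero; suc)
  open import Data.Product.Base using (_,_)
  open import Data.Sum.Base using ([_,_]′)
  open import Data.Vec.Base using ([]; _∷_)
  open import Relation.Nullary.Decidable using (Dec; yes; no)
  open import Relation.Unary using (Pred; Decidable)

  -- Averaging one vertex at a time makes conditioning on S ⊆ V_p a structural recursion;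
  -- `sumOver-subsets` identifies the result with the sum over all outcomes.
  𝔼 : ∀ n → (Subset n → Carrier) → Carrier
  𝔼 zero    f = f []
  𝔼 (suc n) f = p * 𝔼 n (λ W → f (inside ∷ W)) + (1# - p) * 𝔼 n (λ W → f (outside ∷ W))

  𝔼-mono : ∀ n {f g : Subset n → Carrier} → (∀ W → f W ≤ g W) → 𝔼 n f ≤ 𝔼 n g
  𝔼-mono zero    f≤g = f≤g []
  𝔼-mono (suc n) f≤g = +-mono-≤
    (*-monoʳ-≤ 0≤p (𝔼-mono n λ W → f≤g (inside ∷ W)))
    (*-monoʳ-≤ (≤⇒0≤ p≤1) (𝔼-mono n λ W → f≤g (outside ∷ W)))

  𝔼-cong : ∀ n {f g : Subset n → Carrier} → (∀ W → f W ≈ g W) → 𝔼 n f ≈ 𝔼 n g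
  𝔼-cong n f≈g = ≤-antisym (𝔼-mono n λ W → ≤-reflexive (f≈g W)) (𝔼-mono n λ W → ≤-reflexive (sym (f≈g W)))

  𝔼-affine : ∀ n a (f g : Subset n → Carrier) → 𝔼 n (λ W → a * f W + g W) ≈ a * 𝔼 n f + 𝔼 n g
  𝔼-affine zero    a f g = refl
  𝔼-affine (suc n) a f g = trans
    (+-cong (*-congˡ (𝔼-affine n a _ _)) (*-congˡ (𝔼-affine n a _ _)))
    (solve 6 (λ p a f g F G → p :* (a :* f :+ g) :+ (:1 :- p) :* (a :* F :+ G)
        := a :* (p :* f :+ (:1 :- p) :* F) :+ (p :* g :+ (:1 :- p) :* G))
      refl p a (𝔼 n λ W → f (inside ∷ W)) (𝔼 n λ W → g (inside ∷ W))
      (𝔼 n λ W → f (outside ∷ W)) (𝔼 n λ W → g (outside ∷ W)))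

  𝔼-const : ∀ n a → 𝔼 n (λ _ → a) ≈ a
  𝔼-const zero    a = refl
  𝔼-const (suc n) a = trans (+-cong (*-congˡ (𝔼-const n a)) (*-congˡ (𝔼-const n a)))
    (solve 2 (λ p a → p :* a :+ (:1 :- p) :* a := a) refl p a)

  𝔼-nonneg : ∀ n {f : Subset n → Carrier} → (∀ W → 0# ≤ f W) → 0# ≤ 𝔼 n f
  𝔼-nonneg n 0≤f = ≤-trans (≤-reflexive (sym (𝔼-const n 0#))) (𝔼-mono n 0≤f)

  𝔼-*ˡ : ∀ n a (f : Subset n → Carrier) → 𝔼 n (λ W → a * f W) ≈ a * 𝔼 n f
  𝔼-*ˡ n a f = trans (𝔼-cong n λ W → sym (+-identityʳ (a * f W)))
    (trans (𝔼-affine n a f (λ _ → 0#)) (trans (+-congˡ (𝔼-const n 0#)) (+-identityʳ _)))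

  𝔼-+ : ∀ n (f g : Subset n → Carrier) → 𝔼 n (λ W → f W + g W) ≈ 𝔼 n f + 𝔼 n g
  𝔼-+ n f g = trans (𝔼-cong n λ W → +-congʳ (sym (*-identityˡ (f W))))
    (trans (𝔼-affine n 1# f g) (+-congʳ (*-identityˡ _)))

  𝔼-sumOver : ∀ n {a} {X : Set a} (xs : List X) (f : X → Subset n → Carrier) →
    𝔼 n (λ W → sumOver xs (λ x → f x W)) ≈ sumOver xs (λ x → 𝔼 n (f x))
  𝔼-sumOver n []       f = 𝔼-const n 0#
  𝔼-sumOver n (x ∷ xs) f = trans (𝔼-+ n (f x) _) (+-congˡ (𝔼-sumOver n xs f))

  sumOver-subsets : ∀ n (f : Subset n → Carrier) →
    sumOver (subsets n) (λ W → f W * outcomeProbability p W) ≈ 𝔼 n f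
  sumOver-subsets zero    f = solve 1 (λ x → x :* :1 :+ :0 := x) refl (f [])
  sumOver-subsets (suc n) f = trans
    (sumOver-++ (map (inside ∷_) (subsets n)) _ F)
    (+-cong (branch inside p λ W → refl) (branch outside (1# - p) λ W → refl))
    where
    open import Relation.Binary.Reasoning.Setoid setoid
    F : Subset (suc n) → Carrier
    F W = f W * outcomeProbability p W
    branch : ∀ b q → (∀ W → outcomeProbability p (b ∷ W) ≈ q * outcomeProbability p W) →
      sumOver (map (b ∷_) (subsets n)) F ≈ q * 𝔼 n (λ W → f (b ∷ W))
    branch b q prob = begin
      sumOver (map (b ∷_) (subsets n)) F
        ≈⟨ sumOver-map (b ∷_) (subsets n) F ⟩
      sumOver (subsets n) (λ W → F (b ∷ W))
        ≈⟨ sumOver-cong (subsets n) (λ W → trans (*-congˡ (prob W))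
             (solve 3 (λ x q y → x :* (q :* y) := q :* (x :* y)) refl (f (b ∷ W)) q (outcomeProbability p W))) ⟩
      sumOver (subsets n) (λ W → q * (f (b ∷ W) * outcomeProbability p W))
        ≈⟨ sumOver-*ˡ q (subsets n) _ ⟩
      q * sumOver (subsets n) (λ W → f (b ∷ W) * outcomeProbability p W)
        ≈⟨ *-congˡ (sumOver-subsets n λ W → f (b ∷ W)) ⟩
      q * 𝔼 n (λ W → f (b ∷ W)) ∎

  Pr≈𝔼 : ∀ {n ℓ} {E : Pred (Subset n) ℓ} (E? : Decidable E) → Pr p E? ≈ 𝔼 n (λ W → 𝟙 (E? W))
  Pr≈𝔼 {n} E? = trans (sumOver-filter E? (subsets n) _) (sumOver-subsets n (λ W → 𝟙 (E? W)))

  -- Conditioning on S ⊆ V_p amounts to adding S to V_p.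
  𝔼-⊆ : ∀ {n} (S : Subset n) (f : Subset n → Carrier) →
    𝔼 n (λ W → 𝟙 (S ⊆? W) * f W) ≈ p ^ ∣ S ∣ * 𝔼 n (λ W → f (W ∪ S))
  𝔼-⊆ []            f = refl
  𝔼-⊆ {suc n} (outside ∷ S) f = trans
    (+-cong (*-congˡ (𝔼-⊆ S (λ W → f (inside ∷ W)))) (*-congˡ (𝔼-⊆ S (λ W → f (outside ∷ W)))))
    (solve 4 (λ p q F G → p :* (q :* F) :+ (:1 :- p) :* (q :* G) := q :* (p :* F :+ (:1 :- p) :* G))
      refl p (p ^ ∣ S ∣) (𝔼 n (λ W → f (inside ∷ (W ∪ S)))) (𝔼 n (λ W → f (outside ∷ (W ∪ S)))))
  𝔼-⊆ {suc n} (inside ∷ S) f = trans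
    (+-cong (*-congˡ (𝔼-⊆ S (λ W → f (inside ∷ W))))
      (*-congˡ (trans (𝔼-cong n λ W → zeroˡ (f (outside ∷ W))) (𝔼-const n 0#))))
    (solve 3 (λ p q F → p :* (q :* F) :+ (:1 :- p) :* :0 := (p :* q) :* (p :* F :+ (:1 :- p) :* F))
      refl p (p ^ ∣ S ∣) (𝔼 n (λ W → f (inside ∷ (W ∪ S)))))

  𝟙-∪-⊆ : ∀ {n} (A B W : Subset n) → 𝟙 (A ⊆? W) * 𝟙 (B ⊆? W) ≈ 𝟙 (A ∪ B ⊆? W)
  𝟙-∪-⊆ A B W = 𝟙-× (A ⊆? W) (B ⊆? W) (A ∪ B ⊆? W)
    (λ A⊆W B⊆W x∈ → [ A⊆W , B⊆W ]′ (x∈p∪q⁻ A B x∈))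
    (λ A∪B⊆W x∈A → A∪B⊆W (p⊆p∪q B x∈A))
    (λ A∪B⊆W x∈B → A∪B⊆W (q⊆p∪q A B x∈B))

  -- The indicator that no edge of the list lies in W, kept as a product so that it can be expanded
  -- algebraically.
  avoid : ∀ {n} → List (Subset n) → Subset n → Carrier
  avoid []      W = 1#
  avoid (A ∷ L) W = (1# - 𝟙 (A ⊆? W)) * avoid L W

  private
    0≤1-𝟙 : ∀ {n} (A W : Subset n) → 0# ≤ 1# - 𝟙 (A ⊆? W)
    0≤1-𝟙 A W = ≤⇒0≤ (𝟙≤1 (A ⊆? W))

    1-𝟙≤1 : ∀ {n} (A W : Subset n) → 1# - 𝟙 (A ⊆? W) ≤ 1#
    1-𝟙≤1 A W = ≤-by (solve 1 (λ x → :1 :- (:1 :- x) := x) refl (𝟙 (A ⊆? W))) (𝟙-nonneg (A ⊆? W))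

  avoid-nonneg : ∀ {n} L (W : Subset n) → 0# ≤ avoid L W
  avoid-nonneg []      W = 0≤1
  avoid-nonneg (A ∷ L) W = *-nonneg (0≤1-𝟙 A W) (avoid-nonneg L W)

  avoid-∪ : ∀ {n} L (W S : Subset n) → avoid L (W ∪ S) ≤ avoid L W
  avoid-∪ []      W S = ≤-refl
  avoid-∪ (A ∷ L) W S = *-mono-≤ (0≤1-𝟙 A (W ∪ S)) (avoid-nonneg L W)
    (+-monoʳ-≤ 1# (neg-mono-≤ (𝟙-mono (A ⊆? W) (A ⊆? (W ∪ S)) λ A⊆W x∈A → p⊆p∪q S (A⊆W x∈A))))
    (avoid-∪ L W S)

  avoid-∪-disjoint : ∀ {n} {L} (W S : Subset n) → All (Disjoint S) L → avoid L (W ∪ S) ≈ avoid L W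
  avoid-∪-disjoint W S []                        = refl
  avoid-∪-disjoint {L = A ∷ _} W S (S∩A=∅ ∷ rest) = *-cong
    (+-congˡ (-‿cong (≤-antisym
      (𝟙-mono (A ⊆? (W ∪ S)) (A ⊆? W) λ A⊆W∪S x∈A →
        [ (λ x∈W → x∈W) , (λ x∈S → ⊥-elim (S∩A=∅ (_ , x∈p∩q⁺ (x∈S , x∈A)))) ]′ (x∈p∪q⁻ W S (A⊆W∪S x∈A)))
      (𝟙-mono (A ⊆? W) (A ⊆? (W ∪ S)) λ A⊆W x∈A → p⊆p∪q S (A⊆W x∈A)))))
    (avoid-∪-disjoint W S rest)

  avoid-filter : ∀ {n ℓ} {Q : Pred (Subset n) ℓ} (Q? : Decidable Q) L W → avoid L W ≤ avoid (filter Q? L) W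
  avoid-filter Q? []      W = ≤-refl
  avoid-filter Q? (A ∷ L) W with Q? A
  ... | yes _ = *-monoʳ-≤ (0≤1-𝟙 A W) (avoid-filter Q? L W)
  ... | no _  = ≤-trans (*-mono-≤ (0≤1-𝟙 A W) (avoid-nonneg (filter Q? L) W) (1-𝟙≤1 A W) (avoid-filter Q? L W))
                        (≤-reflexive (*-identityˡ _))

  𝔼-avoid-⊆-disjoint : ∀ {n} {L} (S : Subset n) → All (Disjoint S) L →
    𝔼 n (λ W → 𝟙 (S ⊆? W) * avoid L W) ≈ p ^ ∣ S ∣ * 𝔼 n (avoid L)
  𝔼-avoid-⊆-disjoint {n} {L} S disjoint =
    trans (𝔼-⊆ S (avoid L)) (*-congˡ (𝔼-cong n λ W → avoid-∪-disjoint W S disjoint))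

  -- The case of Harris's inequality that Janson's argument uses. Conditioning on S ⊆ V_p enlarges
  -- V_p by S, and enlarging the set can only spoil avoidance.
  𝔼-avoid-⊆ : ∀ {n} L (S : Subset n) → 𝔼 n (λ W → 𝟙 (S ⊆? W) * avoid L W) ≤ p ^ ∣ S ∣ * 𝔼 n (avoid L)
  𝔼-avoid-⊆ {n} L S = ≤-trans (≤-reflexive (𝔼-⊆ S (avoid L)))
    (*-monoʳ-≤ (^-nonneg 0≤p ∣ S ∣) (𝔼-mono n λ W → avoid-∪ L W S))

  mass : ∀ {n} → List (Subset n) → Carrier
  mass L = sumOver L (λ A → p ^ ∣ A ∣)

  meets? : ∀ {n} (A B : Subset n) → Dec (Nonempty (A ∩ B))
  meets? A B = nonempty? (A ∩ B)

  overlapWith : ∀ {n} → Subset n → List (Subset n) → Carrier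
  overlapWith A L = sumOver L (λ B → 𝟙 (meets? A B) * p ^ ∣ A ∪ B ∣)

  -- This is Δ, with each pair charged to its earlier edge, in accordance with the induction in
  -- `janson`.
  totalOverlap : ∀ {n} → List (Subset n) → Carrier
  totalOverlap []      = 0#
  totalOverlap (A ∷ L) = overlapWith A L + totalOverlap L

  private
    weight-nonneg : ∀ {n} (A : Subset n) → 0# ≤ p ^ ∣ A ∣
    weight-nonneg A = ^-nonneg 0≤p ∣ A ∣

  overlapWith-nonneg : ∀ {n} (A : Subset n) L → 0# ≤ overlapWith A L
  overlapWith-nonneg A L = sumOver-nonneg L λ B → *-nonneg (𝟙-nonneg (meets? A B)) (weight-nonneg (A ∪ B))

  totalOverlap-nonneg : ∀ {n} (L : List (Subset n)) → 0# ≤ totalOverlap L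
  totalOverlap-nonneg []      = ≤-refl
  totalOverlap-nonneg (A ∷ L) = +-nonneg (overlapWith-nonneg A L) (totalOverlap-nonneg L)

  Δ≈totalOverlap : ∀ {n} (H : Hypergraph n) → Δ p H ≈ totalOverlap (edges H)
  Δ≈totalOverlap H = trans (sumOver-filter (λ (A , B) → meets? A B) (pairs (edges H)) _) (go (edges H))
    where
    φ : _ → Carrier
    φ (A , B) = 𝟙 (meets? A B) * p ^ ∣ A ∪ B ∣
    go : ∀ L → sumOver (pairs L) φ ≈ totalOverlap L
    go []      = refl
    go (A ∷ L) = trans (sumOver-++ (map (A ,_) L) (pairs L) φ)
      (+-cong (sumOver-map (A ,_) L φ) (go L))

  private
    -- Bonferroni's inequality for the edges of L meeting A.
    avoid-split : ∀ {n} (A : Subset n) L W →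
      avoid (filter (disjoint? A) L) W * (1# - sumOver L (λ B → 𝟙 (meets? A B) * 𝟙 (B ⊆? W))) ≤ avoid L W
    avoid-split A []      W = ≤-reflexive (solve 0 (:1 :* (:1 :- :0) := :1) refl)
    avoid-split A (B ∷ L) W with meets? A B
    ... | yes _ = ≤-by
      (solve 4 (λ F b s V → (:1 :- b) :* V :- F :* (:1 :- (:1 :* b :+ s)) := (V :- F :* (:1 :- s)) :+ b :* (F :- V))
        refl (avoid (filter (disjoint? A) L) W) (𝟙 (B ⊆? W)) _ (avoid L W))
      (+-nonneg (≤⇒0≤ (avoid-split A L W))
        (*-nonneg (𝟙-nonneg (B ⊆? W)) (≤⇒0≤ (avoid-filter (disjoint? A) L W))))
    ... | no _ = ≤-by
      (solve 4 (λ F b s V → (:1 :- b) :* V :- (:1 :- b) :* F :* (:1 :- (:0 :* b :+ s)) := (:1 :- b) :* (V :- F :* (:1 :- s)))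
        refl (avoid (filter (disjoint? A) L) W) (𝟙 (B ⊆? W)) _ (avoid L W))
      (*-nonneg (0≤1-𝟙 B W) (≤⇒0≤ (avoid-split A L W)))

  -- The event A ⊆ V_p is independent of avoiding the edges of L disjoint from A. Bonferroni's
  -- inequality brings back the edges B that meet A, and each of them costs at most the weight of A
  -- ∪ B by `𝔼-avoid-⊆`.
  janson-step : ∀ {n} (A : Subset n) L →
    (p ^ ∣ A ∣ - overlapWith A L) * 𝔼 n (avoid L) ≤ 𝔼 n (λ W → 𝟙 (A ⊆? W) * avoid L W)
  -- Passing from `avoid L` to the larger `avoid I` is sound only for a nonnegative factor q; for q
  -- ≤ 0 the left side is already at most zero.
  janson-step {n} A L = ≤-byTotality 0# q
    (λ 0≤q → ≤-trans (*-monoʳ-≤ 0≤q (𝔼-mono n (avoid-filter (disjoint? A) L))) main)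
    (λ q≤0 → ≤-trans
      (≤-by (solve 2 (λ q V → :0 :- q :* V := (:0 :- q) :* V) refl q (𝔼 n (avoid L)))
        (*-nonneg (≤⇒0≤ q≤0) (𝔼-nonneg n (avoid-nonneg L))))
      (𝔼-nonneg n λ W → *-nonneg (𝟙-nonneg (A ⊆? W)) (avoid-nonneg L W)))
    where
    open ≤-Reasoning
    q : Carrier
    q = p ^ ∣ A ∣ - overlapWith A L
    I : List (Subset n)
    I = filter (disjoint? A) L
    V F : Subset n → Carrier
    V W = 𝟙 (A ⊆? W) * avoid L W
    F W = avoid I W
    G : Subset n → Subset n → Carrier
    G B W = 𝟙 (meets? A B) * (𝟙 (A ∪ B ⊆? W) * F W)
    pointwise : ∀ W → 𝟙 (A ⊆? W) * F W ≤ V W + sumOver L (λ B → G B W)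
    pointwise W = begin
      a * F W
        -- Here s counts the edges of L inside W that meet A; splitting 1 as (1 - s) + s exposes the
        -- left side of `avoid-split`.
        ≈⟨ solve 3 (λ a F s → a :* F := a :* (F :* (:1 :- s)) :+ s :* (a :* F)) refl a (F W) s ⟩
      a * (F W * (1# - s)) + s * (a * F W)
        ≤⟨ +-mono-≤ (*-monoʳ-≤ (𝟙-nonneg (A ⊆? W)) (avoid-split A L W))
             (≤-reflexive (trans (sym (sumOver-*ʳ (a * F W) L _)) (sumOver-cong L λ B →
               trans (solve 4 (λ m b a F → m :* b :* (a :* F) := m :* (a :* b :* F)) refl (𝟙 (meets? A B)) (𝟙 (B ⊆? W)) a (F W))
                     (*-congˡ (*-congʳ (𝟙-∪-⊆ A B W)))))) ⟩
      V W + sumOver L (λ B → G B W) ∎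
      where
      a s : Carrier
      a = 𝟙 (A ⊆? W)
      s = sumOver L (λ B → 𝟙 (meets? A B) * 𝟙 (B ⊆? W))
    expected : p ^ ∣ A ∣ * 𝔼 n F ≤ 𝔼 n V + overlapWith A L * 𝔼 n F
    expected = begin
      p ^ ∣ A ∣ * 𝔼 n F                                ≈⟨ 𝔼-avoid-⊆-disjoint A (all-filter (disjoint? A) L) ⟨
      𝔼 n (λ W → 𝟙 (A ⊆? W) * F W)                     ≤⟨ 𝔼-mono n pointwise ⟩
      𝔼 n (λ W → V W + sumOver L (λ B → G B W))        ≈⟨ trans (𝔼-+ n V _) (+-congˡ (𝔼-sumOver n L G)) ⟩
      𝔼 n V + sumOver L (λ B → 𝔼 n (G B))              ≤⟨ +-monoʳ-≤ _ (sumOver-mono L λ B →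
          ≤-trans (≤-reflexive (𝔼-*ˡ n (𝟙 (meets? A B)) _))
            (≤-trans (*-monoʳ-≤ (𝟙-nonneg (meets? A B)) (𝔼-avoid-⊆ I (A ∪ B))) (≤-reflexive (sym (*-assoc _ _ _))))) ⟩
      𝔼 n V + sumOver L (λ B → 𝟙 (meets? A B) * p ^ ∣ A ∪ B ∣ * 𝔼 n F)
                                                       ≈⟨ +-congˡ (sumOver-*ʳ (𝔼 n F) L _) ⟩
      𝔼 n V + overlapWith A L * 𝔼 n F ∎
    main : q * 𝔼 n F ≤ 𝔼 n V
    main = ≤-by (solve 4 (λ w d F V → V :- (w :- d) :* F := (V :+ d :* F) :- w :* F)
      refl (p ^ ∣ A ∣) (overlapWith A L) (𝔼 n F) (𝔼 n V)) (≤⇒0≤ expected)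

  module _ (EL : ExpLog R) where
    open ExpLog EL
    open Exponential R EL

    -- By `janson-step`, a further edge multiplies the avoidance probability by at most 1 - q ≤ exp
    -- (- q), and the values q add up to the mass minus the overlap.
    janson : ∀ {n} (L : List (Subset n)) → 𝔼 n (avoid L) ≤ exp (- mass L + totalOverlap L)
    janson {n} []      = ≤-reflexive (trans (𝔼-const n 1#)
      (sym (trans (exp-cong (solve 0 (:- :0 :+ :0 := :0) refl)) exp-zero)))
    janson {n} (A ∷ L) = begin
      𝔼 n (avoid (A ∷ L))
        ≈⟨ 𝔼-cong n (λ W → solve 2 (λ a V → (:1 :- a) :* V := (:- :1) :* (a :* V) :+ V) refl (𝟙 (A ⊆? W)) (avoid L W)) ⟩
      𝔼 n (λ W → - 1# * (𝟙 (A ⊆? W) * avoid L W) + avoid L W)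
        ≈⟨ 𝔼-affine n (- 1#) (λ W → 𝟙 (A ⊆? W) * avoid L W) (avoid L) ⟩
      - 1# * 𝔼 n (λ W → 𝟙 (A ⊆? W) * avoid L W) + 𝔼 n (avoid L)
        ≤⟨ ≤-by (solve 3 (λ q V X → (:1 :+ :- q) :* V :- ((:- :1) :* X :+ V) := X :- q :* V)
             refl q (𝔼 n (avoid L)) _) (≤⇒0≤ (janson-step A L)) ⟩
      (1# + - q) * 𝔼 n (avoid L)
        ≤⟨ *-monoˡ-≤ (𝔼-nonneg n (avoid-nonneg L)) (1+x≤exp (- q)) ⟩
      exp (- q) * 𝔼 n (avoid L)
        ≤⟨ *-monoʳ-≤ (exp-nonneg (- q)) (janson L) ⟩
      exp (- q) * exp (- mass L + totalOverlap L)
        ≈⟨ exp-+ (- q) (- mass L + totalOverlap L) ⟨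
      exp (- q + (- mass L + totalOverlap L))
        ≈⟨ exp-cong (solve 4 (λ w d m o → :- (w :- d) :+ (:- m :+ o) := :- (w :+ m) :+ (d :+ o))
             refl (p ^ ∣ A ∣) (overlapWith A L) (mass L) (totalOverlap L)) ⟩
      exp (- mass (A ∷ L) + totalOverlap (A ∷ L)) ∎
      where
      open ≤-Reasoning
      q : Carrier
      q = p ^ ∣ A ∣ - overlapWith A L

-- Greedy construction of maximal matchings.

module GreedyMatching where
  open import Data.Empty using (⊥-elim)
  open import Data.Fin.Subset using (Subset; Nonempty; Empty; _∩_; _⊆_; ⋃)
  open import Data.Fin.Subset.Properties
    using (_⊆?_; nonempty?; x∈p∪q⁻; x∈p∩q⁺; x∈p∩q⁻; ∉⊥; p∩q⊆p; p∩q⊆q; ∩-comm)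
  open import Data.List.Base using (List; []; _∷_; map; filter; length)
  open import Data.List.Membership.Propositional using (_∈_)
  open import Data.List.Membership.Propositional.Properties using (∈-++⁺ˡ; ∈-++⁺ʳ; ∈-++⁻; ∈-map⁺; ∈-map⁻; ∈-filter⁺)
  open import Data.List.Extrema.Nat using (xs≤max)
  open import Data.List.Relation.Unary.All as All using (All; []; _∷_; all?)
  open import Data.List.Relation.Unary.All.Properties using (¬All⇒Any¬)
  open import Data.List.Relation.Unary.AllPairs using (AllPairs; []; _∷_; allPairs?)
  open import Data.List.Relation.Unary.Any as Any using (Any; here; there)
  open import Data.Nat.Base using (ℕ; suc; _+_; _≤_)
  open import Data.Nat.Properties using (+-suc)
  open import Data.Product.Base using (_,_)
  open import Data.Sum.Base using (inj₁; inj₂; [_,_]′)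
  open import Relation.Binary.PropositionalEquality using (_≡_; refl; cong; sym; trans; subst)
  open import Relation.Nullary.Decidable using (yes; no; ¬?; decidable-stable)
  open import Relation.Nullary.Negation using (¬_)
  open import Relation.Unary using (Pred; Decidable)

  empty? : ∀ {n} → Decidable (Empty {n})
  empty? A = ¬? (nonempty? A)

  matching? : ∀ {n} → Decidable (AllPairs (Disjoint {n}))
  matching? = allPairs? disjoint?

  disjointFromAll? : ∀ {n} (M : List (Subset n)) → Decidable (λ B → All (λ A → Disjoint A B) M)
  disjointFromAll? M B = all? (λ A → disjoint? A B) M

  Disjoint-sym : ∀ {n} {A B : Subset n} → Disjoint A B → Disjoint B A
  Disjoint-sym {A = A} {B} A∩B=∅ (x , x∈B∩A) = A∩B=∅ (x , subst (_ ∈ₛ_) (∩-comm B A) x∈B∩A)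
    where open Data.Fin.Subset renaming (_∈_ to _∈ₛ_)

  Empty⇒Disjointˡ : ∀ {n} {A : Subset n} B → Empty A → Disjoint A B
  Empty⇒Disjointˡ {A = A} B A=∅ (x , x∈A∩B) = A=∅ (x , p∩q⊆p A B x∈A∩B)

  Empty⇒Disjointʳ : ∀ {n} (A : Subset n) {B} → Empty B → Disjoint A B
  Empty⇒Disjointʳ A {B} B=∅ (x , x∈A∩B) = B=∅ (x , p∩q⊆q A B x∈A∩B)

  ⋃-disjoint : ∀ {n} {M} (B : Subset n) → All (λ A → Disjoint A B) M → Disjoint (⋃ M) B
  ⋃-disjoint B [] (x , x∈) = ∉⊥ (p∩q⊆p _ B x∈)
  ⋃-disjoint {M = A ∷ M} B (A∩B=∅ ∷ rest) (x , x∈) with x∈p∩q⁻ (⋃ (A ∷ M)) B x∈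
  ... | x∈⋃ , x∈B = [ (λ x∈A → A∩B=∅ (x , x∈p∩q⁺ (x∈A , x∈B)))
                    , (λ x∈⋃M → ⋃-disjoint B rest (x , x∈p∩q⁺ (x∈⋃M , x∈B))) ]′ (x∈p∪q⁻ A (⋃ M) x∈⋃)

  ⋃-⊆ : ∀ {n} {M} {W : Subset n} → All (_⊆ W) M → ⋃ M ⊆ W
  ⋃-⊆ []                      x∈  = ⊥-elim (∉⊥ x∈)
  ⋃-⊆ {M = A ∷ M} (A⊆W ∷ M⊆W) x∈ = [ A⊆W , ⋃-⊆ M⊆W ]′ (x∈p∪q⁻ A (⋃ M) x∈)

  All-sublists : ∀ {a p} {X : Set a} {P : Pred X p} {xs ys} → All P xs → ys ∈ sublists xs → All P ys
  All-sublists {xs = []}     []         (here refl) = []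
  All-sublists {xs = x ∷ xs} (px ∷ pxs) ys∈ with ∈-++⁻ (map (x ∷_) (sublists xs)) ys∈
  ... | inj₂ ys∈ = All-sublists pxs ys∈
  ... | inj₁ ys∈ with ∈-map⁻ (x ∷_) ys∈
  ...   | zs , zs∈ , refl = px ∷ All-sublists pxs zs∈

  length≤ν : ∀ {n} (H : Hypergraph n) {M} → M ∈ sublists (edges H) → AllPairs Disjoint M → length M ≤ ν H
  length≤ν H M∈ matching =
    All.lookup (xs≤max 0 (map length (matchings H))) (∈-map⁺ length (∈-filter⁺ matching? M∈ matching))

  -- In maximalMatching below, M⁺ is M together with all k empty edges.
  record MaximalMatching {n} (W : Subset n) (Cs Ws : List (Subset n)) (k : ℕ) : Set where
    field
      {M M⁺}      : List (Subset n)
      M∈          : M ∈ sublists Cs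
      M-matching  : AllPairs Disjoint M
      M⊆W         : All (_⊆ W) M
      maximal     : All (λ B → B ⊆ W → Any (λ A → Nonempty (A ∩ B)) M) Cs
      M⁺∈         : M⁺ ∈ sublists Ws
      M⁺-matching : AllPairs Disjoint M⁺
      extends     : ∀ {B} → All (Disjoint B) M → All (Disjoint B) M⁺
      M⁺-length   : length M⁺ ≡ length M + k

  module _ {n ℓ} {Core : Pred (Subset n) ℓ} (core? : Decidable Core)
           (core⇒nonempty : ∀ {A} → Core A → Nonempty A) (W : Subset n) where
    open MaximalMatching

    private
      skip∈ : ∀ A xs {M : List (Subset n)} → M ∈ sublists xs → M ∈ sublists (A ∷ xs)
      skip∈ A xs M∈ = ∈-++⁺ʳ (map (A ∷_) (sublists xs)) M∈

      cons∈ : ∀ A xs {M : List (Subset n)} → M ∈ sublists xs → (A ∷ M) ∈ sublists (A ∷ xs)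
      cons∈ A xs M∈ = ∈-++⁺ˡ (∈-map⁺ (A ∷_) M∈)

    -- Working from the tail of the list, a core edge inside W is taken unless it meets a member
    -- already chosen. A taken edge meets itself because core edges are nonempty, and this makes
    -- `maximal` true of members too. An empty edge lies in every W and is disjoint from everything,
    -- so it can always join M⁺.
    maximalMatching : ∀ Es → MaximalMatching W (filter core? Es) (filter (_⊆? W) Es) (length (filter empty? Es))
    maximalMatching [] = record
      { M∈ = here refl ; M-matching = [] ; M⊆W = [] ; maximal = []
      ; M⁺∈ = here refl ; M⁺-matching = [] ; extends = λ _ → [] ; M⁺-length = refl }
    maximalMatching (A ∷ Es) with maximalMatching Es | nonempty? A | core? A | A ⊆? W
    ... | _ | no A=∅  | yes A-core | _ = ⊥-elim (A=∅ (core⇒nonempty A-core))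
    ... | _ | no A=∅  | no _       | no A⊈W = ⊥-elim (A⊈W λ x∈A → ⊥-elim (A=∅ (_ , x∈A)))
    ... | G | no A=∅  | no _       | yes _ = record
      { M∈ = M∈ G ; M-matching = M-matching G ; M⊆W = M⊆W G ; maximal = maximal G
      ; M⁺∈ = cons∈ A (filter (_⊆? W) Es) (M⁺∈ G)
      ; M⁺-matching = All.universal (λ B → Empty⇒Disjointˡ B A=∅) _ ∷ M⁺-matching G
      ; extends = λ {B} dis → Empty⇒Disjointʳ B A=∅ ∷ extends G dis
      ; M⁺-length = trans (cong suc (M⁺-length G)) (sym (+-suc (length (M G)) _)) }
    ... | G | yes _ | no _     | no _ = record
      { M∈ = M∈ G ; M-matching = M-matching G ; M⊆W = M⊆W G ; maximal = maximal G
      ; M⁺∈ = M⁺∈ G ; M⁺-matching = M⁺-matching G ; extends = extends G ; M⁺-length = M⁺-length G }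
    ... | G | yes _ | no _     | yes _ = record
      { M∈ = M∈ G ; M-matching = M-matching G ; M⊆W = M⊆W G ; maximal = maximal G
      ; M⁺∈ = skip∈ A (filter (_⊆? W) Es) (M⁺∈ G) ; M⁺-matching = M⁺-matching G ; extends = extends G ; M⁺-length = M⁺-length G }
    ... | G | yes _ | yes _    | no A⊈W = record
      { M∈ = skip∈ A (filter core? Es) (M∈ G) ; M-matching = M-matching G ; M⊆W = M⊆W G
      ; maximal = (λ A⊆W → ⊥-elim (A⊈W A⊆W)) ∷ maximal G
      ; M⁺∈ = M⁺∈ G ; M⁺-matching = M⁺-matching G ; extends = extends G ; M⁺-length = M⁺-length G }
    ... | G | yes A≠∅ | yes _  | yes A⊆W with all? (disjoint? A) (M G)
    ...   | yes A-disjoint = record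
      { M∈ = cons∈ A (filter core? Es) (M∈ G) ; M-matching = A-disjoint ∷ M-matching G ; M⊆W = A⊆W ∷ M⊆W G
      ; maximal = (λ _ → here (self-meet A≠∅)) ∷ All.map (λ {B} → weaken B) (maximal G)
      -- Only disjointness from M has been tested; `extends` carries it over to the empty edges in
      -- M⁺.
      ; M⁺∈ = cons∈ A (filter (_⊆? W) Es) (M⁺∈ G) ; M⁺-matching = extends G A-disjoint ∷ M⁺-matching G
      ; extends = λ { (d ∷ dis) → d ∷ extends G dis } ; M⁺-length = cong suc (M⁺-length G) }
      where
      self-meet : Nonempty A → Nonempty (A ∩ A)
      self-meet (x , x∈A) = x , x∈p∩q⁺ (x∈A , x∈A)
      weaken : ∀ B → (B ⊆ W → Any (λ A → Nonempty (A ∩ B)) (M G)) → B ⊆ W → Any (λ A → Nonempty (A ∩ B)) (A ∷ M G)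
      weaken B f B⊆W = there (f B⊆W)
    ...   | no A-meets = record
      { M∈ = skip∈ A (filter core? Es) (M∈ G) ; M-matching = M-matching G ; M⊆W = M⊆W G
      ; maximal = (λ _ → Any.map meets-sym (¬All⇒Any¬ (disjoint? A) _ A-meets)) ∷ maximal G
      ; M⁺∈ = skip∈ A (filter (_⊆? W) Es) (M⁺∈ G) ; M⁺-matching = M⁺-matching G ; extends = extends G ; M⁺-length = M⁺-length G }
      where
      meets-sym : ∀ {B} → ¬ Disjoint A B → Nonempty (B ∩ A)
      meets-sym {B} ¬disjoint = decidable-stable (nonempty? (B ∩ A)) λ B∩A=∅ → ¬disjoint (Disjoint-sym B∩A=∅)

-- Weights, degrees and neighbourhoods of edges.

module SubsetWeights {c ℓ₁ ℓ₂} (R : RealField c ℓ₁ ℓ₂) (p : RealField.Carrier R)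
  (0≤p : RealField._≤_ R (RealField.0# R) p) (p≤1 : RealField._≤_ R p (RealField.1# R)) where
  open Reals R
  open Weights R
  open Order R
  open Sums R
  open Probability R p 0≤p p≤1
  open GreedyMatching
  open import Data.Empty using (⊥-elim)
  open import Data.Fin.Base using (suc)
  open import Data.Fin.Subset using (Subset; inside; outside; Nonempty; Empty; _∪_; _∩_; ∣_∣)
  open import Data.Fin.Subset.Properties using (Empty-unique; ∣⊥∣≡0)
  open import Data.List.Base using (List; []; _∷_; filter)
  open import Data.List.Membership.Propositional using (_∈_)
  open import Data.List.Relation.Unary.All as All using (All; []; _∷_)
  open import Data.List.Relation.Unary.AllPairs using ([]; _∷_)
  open import Data.List.Relation.Unary.Any using (here; there)
  open import Data.List.Relation.Unary.Unique.Propositional using (Unique)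
  open import Data.Nat.Base using (ℕ; zero; suc)
  open import Data.Product.Base using (_×_; _,_)
  open import Data.Vec.Base using ([]; _∷_; there)
  open import Data.Vec.Properties using (≡-dec)
  import Data.Bool.Properties as Bool
  open import Relation.Binary.PropositionalEquality as ≡ using (_≡_; _≢_)
  open import Relation.Nullary.Decidable using (Dec; yes; no; ¬?; _×-dec_)
  open import Relation.Unary using (Pred; Decidable)

  private variable
    n : ℕ

  weight : Subset n → Carrier
  weight A = p ^ ∣ A ∣

  weight-nonneg : (A : Subset n) → 0# ≤ weight A
  weight-nonneg A = ^-nonneg 0≤p ∣ A ∣

  ^≤1 : ∀ k → p ^ k ≤ 1#
  ^≤1 zero    = ≤-refl
  ^≤1 (suc k) = ≤-trans (*-mono-≤ 0≤p 0≤1 p≤1 (^≤1 k)) (≤-reflexive (*-identityˡ 1#))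

  weight≤p : (A : Subset n) → Nonempty A → weight A ≤ p
  weight≤p (inside ∷ A)  _                   = ≤-trans (*-monoʳ-≤ 0≤p (^≤1 ∣ A ∣)) (≤-reflexive (*-identityʳ p))
  weight≤p (outside ∷ A) (suc x , there x∈A) = weight≤p A (x , x∈A)

  weight-∪-∩ : (A B : Subset n) → weight A * weight B ≈ weight (A ∪ B) * weight (A ∩ B)
  weight-∪-∩ []            []            = refl
  weight-∪-∩ (outside ∷ A) (outside ∷ B) = weight-∪-∩ A B
  weight-∪-∩ (outside ∷ A) (inside ∷ B)  = trans (solve 3 (λ p a b → a :* (p :* b) := p :* (a :* b)) refl p _ _)
    (trans (*-congˡ (weight-∪-∩ A B)) (sym (*-assoc _ _ _)))
  weight-∪-∩ (inside ∷ A)  (outside ∷ B) = trans (*-assoc _ _ _)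
    (trans (*-congˡ (weight-∪-∩ A B)) (sym (*-assoc _ _ _)))
  weight-∪-∩ (inside ∷ A)  (inside ∷ B)  = trans (solve 3 (λ p a b → p :* a :* (p :* b) := p :* p :* (a :* b)) refl p _ _)
    (trans (*-congˡ (weight-∪-∩ A B)) (solve 3 (λ p a b → p :* p :* (a :* b) := p :* a :* (p :* b)) refl p _ _))

  -- A shared vertex is paid for twice on the left. This is the origin of the factor p in 2αp/η.
  weight-meeting : (A B : Subset n) → Nonempty (A ∩ B) → weight A * weight B ≤ p * weight (A ∪ B)
  weight-meeting A B A∩B≠∅ = ≤-trans (≤-reflexive (trans (weight-∪-∩ A B) (*-comm _ _)))
    (*-monoˡ-≤ (weight-nonneg (A ∪ B)) (weight≤p (A ∩ B) A∩B≠∅))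

  weight-empty : (A : Subset n) → Empty A → weight A ≈ 1#
  weight-empty {n} A A=∅ = reflexive (≡.trans (≡.cong weight (Empty-unique A=∅)) (≡.cong (p ^_) (∣⊥∣≡0 n)))

  weight-disjoint : (A B : Subset n) → Disjoint A B → weight (A ∪ B) ≈ weight A * weight B
  weight-disjoint A B A∩B=∅ = sym (trans (weight-∪-∩ A B)
    (trans (*-congˡ (weight-empty (A ∩ B) A∩B=∅)) (*-identityʳ _)))

  mass-filter : ∀ {ℓ} {Q : Pred (Subset n) ℓ} (Q? : Decidable Q) L {f : Subset n → Carrier} → (∀ A → 0# ≤ f A) →
    sumOver (filter Q? L) f ≤ sumOver L f
  mass-filter Q? L {f} 0≤f = ≤-trans (≤-reflexive (sumOver-filter Q? L f)) (sumOver-mono L λ A →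
    ≤-trans (*-monoˡ-≤ (0≤f A) (𝟙≤1 (Q? A))) (≤-reflexive (*-identityˡ (f A))))

  totalOverlap-filter : ∀ {ℓ} {Q : Pred (Subset n) ℓ} (Q? : Decidable Q) L → totalOverlap (filter Q? L) ≤ totalOverlap L
  totalOverlap-filter Q? []      = ≤-refl
  totalOverlap-filter Q? (A ∷ L) with Q? A
  ... | yes _ = +-mono-≤ (mass-filter Q? L λ B → *-nonneg (𝟙-nonneg (meets? A B)) (weight-nonneg (A ∪ B)))
                         (totalOverlap-filter Q? L)
  ... | no _  = ≤-trans (totalOverlap-filter Q? L)
    (≤-by (solve 2 (λ o t → (o :+ t) :- t := o) refl (overlapWith A L) (totalOverlap L)) (overlapWith-nonneg A L))

  sumOver-mono-All : ∀ {a} {X : Set a} {xs : List X} {f g : X → Carrier} →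
    All (λ x → f x ≤ g x) xs → sumOver xs f ≤ sumOver xs g
  sumOver-mono-All []            = ≤-refl
  sumOver-mono-All (f≤g ∷ fs≤gs) = +-mono-≤ f≤g (sumOver-mono-All fs≤gs)

  term≤sumOver : ∀ {a} {X : Set a} {xs : List X} {f : X → Carrier} {x} → (∀ x → 0# ≤ f x) →
    x ∈ xs → f x ≤ sumOver xs f
  term≤sumOver {xs = y ∷ xs} {f} 0≤f (here ≡.refl) =
    ≤-by (solve 2 (λ a s → (a :+ s) :- a := s) refl (f y) (sumOver xs f)) (sumOver-nonneg xs 0≤f)
  term≤sumOver {xs = y ∷ xs} {f} 0≤f (there x∈xs) = ≤-trans (term≤sumOver 0≤f x∈xs)
    (≤-by (solve 2 (λ a s → (a :+ s) :- s := a) refl (f y) (sumOver xs f)) (0≤f y))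

  -- Δ sees only pairs of distinct edges, so the square of the weight of A could not be charged to
  -- it. Hence A is kept out of its own degree and returns in `neighbourhood`, at a cost of at most
  -- p if it is nonempty.
  conflict? : (A B : Subset n) → Dec (Nonempty (A ∩ B) × A ≢ B)
  conflict? A B = meets? A B ×-dec ¬? (≡-dec Bool._≟_ A B)

  degree : List (Subset n) → Subset n → Carrier
  degree L A = sumOver L (λ B → 𝟙 (conflict? A B) * weight B)

  degree-nonneg : ∀ L (A : Subset n) → 0# ≤ degree L A
  degree-nonneg L A = sumOver-nonneg L λ B → *-nonneg (𝟙-nonneg (conflict? A B)) (weight-nonneg B)

  private
    conflict-≤ : (A B : Subset n) → weight A * (𝟙 (conflict? A B) * weight B) ≤ p * (𝟙 (meets? A B) * weight (A ∪ B))
    conflict-≤ A B with meets? A B | ≡-dec Bool._≟_ A B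
    ... | yes A∩B≠∅ | no _ = begin
      weight A * (1# * weight B)      ≈⟨ *-congˡ (*-identityˡ _) ⟩
      weight A * weight B             ≤⟨ weight-meeting A B A∩B≠∅ ⟩
      p * weight (A ∪ B)              ≈⟨ *-congˡ (*-identityˡ _) ⟨
      p * (1# * weight (A ∪ B))       ∎
      where open ≤-Reasoning
    ... | yes A∩B≠∅ | yes _ = ≤-trans (≤-reflexive (solve 2 (λ a b → a :* (:0 :* b) := :0) refl _ _))
      (*-nonneg 0≤p (*-nonneg 0≤1 (weight-nonneg (A ∪ B))))
    ... | no _ | _ = ≤-reflexive (solve 4 (λ a b p u → a :* (:0 :* b) := p :* (:0 :* u)) refl _ _ _ _)

    conflict-self : (A : Subset n) → 𝟙 (conflict? A A) ≈ 0#
    conflict-self A with meets? A A | ≡-dec Bool._≟_ A A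
    ... | _     | no A≢A = ⊥-elim (A≢A ≡.refl)
    ... | yes _ | yes _  = refl
    ... | no _  | yes _  = refl

    overlap-sym : (A B : Subset n) → 𝟙 (meets? B A) * weight (B ∪ A) ≈ 𝟙 (meets? A B) * weight (A ∪ B)
    overlap-sym A B = *-cong
      (≤-antisym (𝟙-mono (meets? B A) (meets? A B) (λ { (x , x∈) → x , ≡.subst (x ∈ₛ_) (∩-comm B A) x∈ }))
                 (𝟙-mono (meets? A B) (meets? B A) (λ { (x , x∈) → x , ≡.subst (x ∈ₛ_) (∩-comm A B) x∈ })))
      (reflexive (≡.cong weight (∪-comm B A)))
      where
      open import Data.Fin.Subset renaming (_∈_ to _∈ₛ_) using ()
      open import Data.Fin.Subset.Properties using (∩-comm; ∪-comm)

  -- Each pair of distinct intersecting edges is counted twice on the left.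
  sumOver-degree-≤ : (L : List (Subset n)) →
    sumOver L (λ A → weight A * degree L A) ≤ fromℕ 2 * (p * totalOverlap L)
  sumOver-degree-≤ []      = ≤-reflexive (solve 1 (λ p → :0 := (:1 :+ (:1 :+ :0)) :* (p :* :0)) refl p)
  sumOver-degree-≤ (A ∷ L) = begin
    weight A * (𝟙 (conflict? A A) * weight A + degree L A)
      + sumOver L (λ B → weight B * (𝟙 (conflict? B A) * weight A + degree L B))
      ≈⟨ +-cong (trans (*-congˡ (trans (+-congʳ (trans (*-congʳ (conflict-self A)) (zeroˡ _))) (+-identityˡ _)))
                       (sym (sumOver-*ˡ (weight A) L _)))
                (trans (sumOver-cong L λ B → distribˡ _ _ _) (sumOver-+ L _ _)) ⟩
    sumOver L (λ B → weight A * (𝟙 (conflict? A B) * weight B))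
      + (sumOver L (λ B → weight B * (𝟙 (conflict? B A) * weight A)) + sumOver L (λ B → weight B * degree L B))
      ≤⟨ +-mono-≤ (≤-trans (sumOver-mono L (conflict-≤ A)) (≤-reflexive (sumOver-*ˡ p L _)))
          (+-mono-≤ (≤-trans (sumOver-mono L λ B → ≤-trans (conflict-≤ B A) (≤-reflexive (*-congˡ (overlap-sym A B))))
                             (≤-reflexive (sumOver-*ˡ p L _)))
                    (sumOver-degree-≤ L)) ⟩
    p * overlapWith A L + (p * overlapWith A L + fromℕ 2 * (p * totalOverlap L))
      ≈⟨ solve 3 (λ p o t → p :* o :+ (p :* o :+ (:1 :+ (:1 :+ :0)) :* (p :* t)) := (:1 :+ (:1 :+ :0)) :* (p :* (o :+ t)))
           refl p (overlapWith A L) (totalOverlap L) ⟩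
    fromℕ 2 * (p * totalOverlap (A ∷ L)) ∎
    where open ≤-Reasoning

  -- The mass that is lost to `rest` when A joins the matching; for nonempty A in the list it
  -- includes A itself.
  neighbourhood : List (Subset n) → Subset n → Carrier
  neighbourhood L A = sumOver L (λ B → 𝟙 (meets? A B) * weight B)

  private
    sumOver-≡ : ∀ {L : List (Subset n)} A → Unique L → sumOver L (λ B → 𝟙 (≡-dec Bool._≟_ A B) * weight B) ≤ weight A
    sumOver-≡ A [] = weight-nonneg A
    sumOver-≡ {L = B ∷ L} A (B∉L ∷ unique) with ≡-dec Bool._≟_ A B
    ... | no _       = ≤-trans (≤-reflexive (trans (+-congʳ (zeroˡ _)) (+-identityˡ _))) (sumOver-≡ A unique)
    ... | yes ≡.refl = ≤-reflexive (trans (+-cong (*-identityˡ _) (vanish B∉L)) (+-identityʳ _))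
      where
      vanish : ∀ {L} → All (B ≢_) L → sumOver L (λ C → 𝟙 (≡-dec Bool._≟_ B C) * weight C) ≈ 0#
      vanish []                      = refl
      vanish (_∷_ {x = C} B≢C B∉L) with ≡-dec Bool._≟_ B C
      ... | yes B≡C = ⊥-elim (B≢C B≡C)
      ... | no _    = trans (+-cong (zeroˡ _) (vanish B∉L)) (+-identityˡ _)

    meets-≤ : (A B : Subset n) → 𝟙 (meets? A B) ≤ 𝟙 (conflict? A B) + 𝟙 (≡-dec Bool._≟_ A B)
    meets-≤ A B with meets? A B | ≡-dec Bool._≟_ A B
    ... | yes _ | yes _ = ≤-reflexive (sym (+-identityˡ 1#))
    ... | yes _ | no _  = ≤-reflexive (sym (+-identityʳ 1#))
    ... | no _  | yes _ = +-nonneg ≤-refl 0≤1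
    ... | no _  | no _  = +-nonneg ≤-refl ≤-refl

  -- An edge meeting A is in conflict with A or equal to it, and uniqueness allows only one copy of
  -- A.
  neighbourhood-≤ : ∀ {L : List (Subset n)} A → Unique L → neighbourhood L A ≤ degree L A + weight A
  neighbourhood-≤ {L = L} A unique = ≤-trans
    (sumOver-mono L λ B → ≤-trans (*-monoˡ-≤ (weight-nonneg B) (meets-≤ A B)) (≤-reflexive (distribʳ _ _ _)))
    (≤-trans (≤-reflexive (sumOver-+ L _ _)) (+-monoʳ-≤ _ (sumOver-≡ A unique)))

  private
    1≤disjoint+meets : ∀ M (B : Subset n) → 1# ≤ 𝟙 (disjointFromAll? M B) + sumOver M (λ A → 𝟙 (meets? A B))
    1≤disjoint+meets []      B = ≤-reflexive (sym (+-identityʳ 1#))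
    1≤disjoint+meets (A ∷ M) B with meets? A B
    ... | yes A∩B≠∅ = ≤-by (solve 2 (λ a s → (a :+ (:1 :+ s)) :- :1 := a :+ s) refl _ _)
      (+-nonneg ≤-refl (sumOver-nonneg M λ A → 𝟙-nonneg (meets? A B)))
    ... | no A∩B=∅ = ≤-trans (1≤disjoint+meets M B) (+-mono-≤ ≤-refl (≤-reflexive (sym (+-identityˡ _))))

  rest : List (Subset n) → List (Subset n) → List (Subset n)
  rest L M = filter (disjointFromAll? M) L

  -- A union bound: an edge outside `rest` meets some member of M and is counted in the
  -- neighbourhood of each member it meets.
  mass-rest : ∀ L (M : List (Subset n)) → mass L ≤ mass (rest L M) + sumOver M (neighbourhood L)
  mass-rest L M = begin
    mass L
      ≤⟨ sumOver-mono L (λ B → ≤-trans (≤-reflexive (sym (*-identityˡ _)))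
           (≤-trans (*-monoˡ-≤ (weight-nonneg B) (1≤disjoint+meets M B))
             (≤-reflexive (trans (distribʳ _ _ _) (+-congˡ (sym (sumOver-*ʳ (weight B) M _))))))) ⟩
    sumOver L (λ B → 𝟙 (disjointFromAll? M B) * weight B + sumOver M (λ A → 𝟙 (meets? A B) * weight B))
      ≈⟨ sumOver-+ L _ _ ⟩
    sumOver L (λ B → 𝟙 (disjointFromAll? M B) * weight B) + sumOver L (λ B → sumOver M (λ A → 𝟙 (meets? A B) * weight B))
      ≈⟨ +-cong (sym (sumOver-filter (disjointFromAll? M) L weight)) (swap L M) ⟩
    mass (rest L M) + sumOver M (neighbourhood L) ∎
    where
    open ≤-Reasoning
    swap : ∀ L M → sumOver L (λ B → sumOver M (λ A → 𝟙 (meets? A B) * weight B)) ≈ sumOver M (neighbourhood L)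
    swap L []      = zeros L
      where
      zeros : ∀ L → sumOver L (λ _ → 0#) ≈ 0#
      zeros []      = refl
      zeros (_ ∷ L) = trans (+-identityˡ _) (zeros L)
    swap L (A ∷ M) = trans (sumOver-+ L _ _) (+-congˡ (swap L M))

-- The tilted union bound over matchings.

module MatchingTail {c ℓ₁ ℓ₂} (R : RealField c ℓ₁ ℓ₂) (EL : ExpLog R)
  {n : ℕ} (H : Hypergraph n) (p : RealField.Carrier R)
  (0≤p : RealField._≤_ R (RealField.0# R) p) (p≤1 : RealField._≤_ R p (RealField.1# R)) where
  open Reals R
  open ExpLog EL
  open Weights R
  open Order R
  open Sums R
  open Exponential R EL
  open Probability R p 0≤p p≤1
  open SubsetWeights R p 0≤p p≤1
  open GreedyMatching
  open import Data.Empty using (⊥-elim)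
  open import Data.Fin.Subset using (Nonempty; _∩_; _⊆_; ⋃)
  open import Data.Fin.Subset.Properties using (_⊆?_; ∣⊥∣≡0)
  open import Data.List.Base using (List; []; _∷_; map; foldr; filter; length)
  open import Data.List.Relation.Unary.All as All using (All; []; _∷_)
  open import Data.List.Relation.Unary.All.Properties as All using (all-filter)
  open import Data.List.Relation.Unary.AllPairs using (AllPairs; []; _∷_)
  open import Data.List.Relation.Unary.Any using (Any)
  open import Data.Product.Base using (_,_)
  import Relation.Binary.PropositionalEquality as ≡
  open import Relation.Nullary.Decidable using (Dec; yes; no)
  open import Relation.Nullary.Negation using (¬_)

  prodOver : ∀ {a} {X : Set a} → List X → (X → Carrier) → Carrier
  prodOver xs w = foldr (λ x t → w x * t) 1# xs

  prodOver-nonneg : ∀ {a} {X : Set a} (xs : List X) {w} → (∀ x → 0# ≤ w x) → 0# ≤ prodOver xs w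
  prodOver-nonneg []       0≤w = 0≤1
  prodOver-nonneg (x ∷ xs) 0≤w = *-nonneg (0≤w x) (prodOver-nonneg xs 0≤w)

  -- The left side is the expansion of the product of the factors 1 + w x, each of which is at most
  -- exp (w x).
  sumOver-sublists-≤ : ∀ {a} {X : Set a} (xs : List X) {w} → (∀ x → 0# ≤ w x) →
    sumOver (sublists xs) (λ ys → prodOver ys w) ≤ exp (sumOver xs w)
  sumOver-sublists-≤ []       0≤w = ≤-reflexive (trans (+-identityʳ 1#) (sym exp-zero))
  sumOver-sublists-≤ (x ∷ xs) {w} 0≤w = begin
    sumOver (sublists (x ∷ xs)) Π
      ≈⟨ trans (sumOver-++ (map (x ∷_) (sublists xs)) (sublists xs) Π)
           (+-congʳ (trans (sumOver-map (x ∷_) (sublists xs) Π) (sumOver-*ˡ (w x) (sublists xs) Π))) ⟩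
    w x * P + P
      ≈⟨ solve 2 (λ w P → w :* P :+ P := (:1 :+ w) :* P) refl (w x) P ⟩
    (1# + w x) * P
      ≤⟨ *-mono-≤ (+-nonneg 0≤1 (0≤w x)) (exp-nonneg _) (1+x≤exp (w x)) (sumOver-sublists-≤ xs 0≤w) ⟩
    exp (w x) * exp (sumOver xs w)
      ≈⟨ exp-+ (w x) (sumOver xs w) ⟨
    exp (sumOver (x ∷ xs) w) ∎
    where
    open ≤-Reasoning
    Π = λ ys → prodOver ys w
    P = sumOver (sublists xs) Π

  avoid≈1 : ∀ {W : Subset n} L → All (λ B → ¬ B ⊆ W) L → avoid L W ≈ 1#
  avoid≈1 [] [] = refl
  avoid≈1 {W} (B ∷ L) (B⊈W ∷ L⊈W) with B ⊆? W
  ... | yes B⊆W = ⊥-elim (B⊈W B⊆W)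
  ... | no _    = trans (*-congˡ (avoid≈1 L L⊈W)) (solve 0 ((:1 :- :0) :* :1 := :1) refl)

  -- Each matching M among the core edges is charged the probability that
  -- M ⊆ V_p and no core edge disjoint from M lies in V_p.  Of the tilt
  -- κ + ℓ per edge, κ pays for the mass of the core edges meeting M, and
  -- exp (- ℓ) = α.

  module _ {ℓ′} {Core : Subset n → Set ℓ′} (core? : Decidable Core)
           (core⇒nonempty : ∀ {A} → Core A → Nonempty A)
           (κ : Carrier) (0≤κ : 0# ≤ κ)
           (core-neighbourhood : ∀ {A} → Core A → neighbourhood (edges H) A ≤ κ)
           (α : Carrier) (0≤α : 0# ≤ α)
           (ℓ : Carrier) (0≤ℓ : 0# ≤ ℓ) (exp-ℓ : exp (- ℓ) ≈ α) where

    Cs : List (Subset n)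
    Cs = filter core? (edges H)

    size : List (Subset n) → Carrier
    size M = fromℕ (length M)

    event : List (Subset n) → Subset n → Carrier
    event M W = 𝟙 (⋃ M ⊆? W) * avoid (rest Cs M) W

    -- Edges in `rest Cs M` share no vertex with ⋃ M, so the two factors of the event are
    -- independent.
    𝔼-event : ∀ M → 𝔼 n (event M) ≈ weight (⋃ M) * 𝔼 n (avoid (rest Cs M))
    𝔼-event M = 𝔼-avoid-⊆-disjoint (⋃ M)
      (All.map (λ {B} → ⋃-disjoint B) (all-filter (disjointFromAll? M) Cs))

    sumOver-neighbourhood-≤ : ∀ M → All Core M → sumOver M (neighbourhood Cs) ≤ κ * size M
    sumOver-neighbourhood-≤ []      []              = ≤-reflexive (sym (zeroʳ κ))
    sumOver-neighbourhood-≤ (A ∷ M) (A-core ∷ core) = ≤-trans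
      (+-mono-≤
        (≤-trans (mass-filter core? (edges H) λ B → *-nonneg (𝟙-nonneg (meets? A B)) (weight-nonneg B))
                 (core-neighbourhood A-core))
        (sumOver-neighbourhood-≤ M core))
      (≤-reflexive (solve 2 (λ κ s → κ :+ κ :* s := κ :* (:1 :+ s)) refl κ (size M)))

    weight-matching : ∀ M → AllPairs Disjoint M →
      exp (- (ℓ * size M)) * weight (⋃ M) ≈ prodOver M (λ A → α * weight A)
    weight-matching [] [] = trans
      (*-cong (trans (exp-cong (solve 1 (λ l → :- (l :* :0) := :0) refl ℓ)) exp-zero)
              (reflexive (≡.cong (p ^_) (∣⊥∣≡0 n))))
      (*-identityˡ 1#)
    weight-matching (A ∷ M) (A-disjoint ∷ matching) = trans
      (*-cong
        (trans (exp-cong (solve 2 (λ l s → :- (l :* (:1 :+ s)) := :- l :+ :- (l :* s)) refl ℓ (size M)))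
               (trans (exp-+ (- ℓ) (- (ℓ * size M))) (*-congʳ exp-ℓ)))
        (weight-disjoint A (⋃ M) (Disjoint-sym (⋃-disjoint A (All.map Disjoint-sym A-disjoint)))))
      (trans (solve 4 (λ α e a m → α :* e :* (a :* m) := α :* a :* (e :* m))
               refl α (exp (- (ℓ * size M))) (weight A) (weight (⋃ M)))
             (*-congˡ (weight-matching M matching)))

    module _ (x : Carrier) where

      -- At least 1 as soon as M has at most x members, so it can replace that restriction on M, as
      -- in an exponential Markov bound.
      tilt : List (Subset n) → Carrier
      tilt M = exp ((ℓ + κ) * (x - size M))

      term : List (Subset n) → Subset n → Carrier
      term M W = 𝟙 (matching? M) * tilt M * event M W

      bound-exponent : Carrier
      bound-exponent = (ℓ + κ) * x - mass Cs + totalOverlap (edges H)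

      -- The part κ * size M of the tilt cancels the mass lost in passing from `Cs` to `rest Cs M`.
      -- The exponent that remains is common to all M, and exp (- (ℓ * size M)) gives one factor α
      -- to each member.
      𝔼-term-≤ : ∀ M → All Core M →
        𝔼 n (term M) ≤ exp bound-exponent * prodOver M (λ A → α * weight A)
      𝔼-term-≤ M core = ≤-trans (≤-reflexive (𝔼-*ˡ n (𝟙 (matching? M) * tilt M) (event M))) (byMatching (matching? M))
        where
        open ≤-Reasoning
        mass-≤ : mass Cs ≤ mass (rest Cs M) + κ * size M
        mass-≤ = ≤-trans (mass-rest Cs M) (+-monoʳ-≤ _ (sumOver-neighbourhood-≤ M core))
        overlap-≤ : totalOverlap (rest Cs M) ≤ totalOverlap (edges H)
        overlap-≤ = ≤-trans (totalOverlap-filter (disjointFromAll? M) Cs) (totalOverlap-filter core? (edges H))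
        exponent-≤ : (ℓ + κ) * (x - size M) + (- mass (rest Cs M) + totalOverlap (rest Cs M))
          ≤ bound-exponent + - (ℓ * size M)
        exponent-≤ = ≤-by
          (solve 8 (λ l k x s m′ o′ m o →
              (((l :+ k) :* x :- m :+ o) :+ :- (l :* s)) :- ((l :+ k) :* (x :- s) :+ (:- m′ :+ o′))
              := ((m′ :+ k :* s) :- m) :+ (o :- o′))
            refl ℓ κ x (size M) (mass (rest Cs M)) (totalOverlap (rest Cs M)) (mass Cs) (totalOverlap (edges H)))
          (+-nonneg (≤⇒0≤ mass-≤) (≤⇒0≤ overlap-≤))
        byMatching : (M? : Dec (AllPairs Disjoint M)) →
          𝟙 M? * tilt M * 𝔼 n (event M) ≤ exp bound-exponent * prodOver M (λ A → α * weight A)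
        byMatching (no _) = ≤-trans
          (≤-reflexive (trans (*-assoc _ _ _) (zeroˡ _)))
          (*-nonneg (exp-nonneg _) (prodOver-nonneg M λ A → *-nonneg 0≤α (weight-nonneg A)))
        byMatching (yes matching) = begin
          1# * tilt M * 𝔼 n (event M)
            ≈⟨ *-cong (*-identityˡ _) (𝔼-event M) ⟩
          tilt M * (weight (⋃ M) * 𝔼 n (avoid (rest Cs M)))
            ≤⟨ *-monoʳ-≤ (exp-nonneg _) (*-monoʳ-≤ (weight-nonneg (⋃ M)) (janson EL (rest Cs M))) ⟩
          tilt M * (weight (⋃ M) * exp (- mass (rest Cs M) + totalOverlap (rest Cs M)))
            ≈⟨ trans (solve 3 (λ t w e → t :* (w :* e) := (t :* e) :* w) refl _ _ _) (*-congʳ (sym (exp-+ _ _))) ⟩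
          exp ((ℓ + κ) * (x - size M) + (- mass (rest Cs M) + totalOverlap (rest Cs M))) * weight (⋃ M)
            ≤⟨ *-monoˡ-≤ (weight-nonneg (⋃ M)) (exp-mono exponent-≤) ⟩
          exp (bound-exponent + - (ℓ * size M)) * weight (⋃ M)
            ≈⟨ trans (*-congʳ (exp-+ _ _)) (*-assoc _ _ _) ⟩
          exp bound-exponent * (exp (- (ℓ * size M)) * weight (⋃ M))
            ≈⟨ *-congˡ (weight-matching M matching) ⟩
          exp bound-exponent * prodOver M (λ A → α * weight A) ∎

      term-nonneg : ∀ W M → 0# ≤ term M W
      term-nonneg W M = *-nonneg (*-nonneg (𝟙-nonneg (matching? M)) (exp-nonneg _))
        (*-nonneg (𝟙-nonneg (⋃ M ⊆? W)) (avoid-nonneg (rest Cs M) W))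

      -- The greedy matching M of W contributes at least 1: M⁺ has at most ν members, so M has at
      -- most x, and by maximality W contains no edge of `rest Cs M`.
      1≤sumOver-terms : ∀ W → fromℕ (ν (H ⟦ W ⟧)) ≤ x + fromℕ (length (filter empty? (edges H))) →
        1# ≤ sumOver (sublists Cs) (λ M → term M W)
      1≤sumOver-terms W ν≤ = ≤-trans 1≤term (term≤sumOver (term-nonneg W) M∈)
        where
        open MaximalMatching (maximalMatching core? core⇒nonempty W (edges H))
        ε : Carrier
        ε = fromℕ (length (filter empty? (edges H)))
        size≤x : size M ≤ x
        size≤x = ≤-by (solve 3 (λ x s e → x :- s := (x :+ e) :- (s :+ e)) refl x (size M) ε) (≤⇒0≤ (≤-trans
          (≤-reflexive (sym (trans (reflexive (≡.cong fromℕ M⁺-length)) (fromℕ-+ (length M) _))))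
          (≤-trans (fromℕ-mono (length≤ν (H ⟦ W ⟧) M⁺∈ M⁺-matching)) ν≤)))
        outside-W : ∀ {B} → (B ⊆ W → Any (λ A → Nonempty (A ∩ B)) M) → All (λ A → Disjoint A B) M → ¬ B ⊆ W
        outside-W B-meets B-disjoint B⊆W = All.All¬⇒¬Any B-disjoint (B-meets B⊆W)
        rest-outside-W : All (λ B → ¬ B ⊆ W) (rest Cs M)
        rest-outside-W = All.zipWith (λ {B} (f , d) → outside-W {B} f d)
          (All.filter⁺ (disjointFromAll? M) maximal , all-filter (disjointFromAll? M) Cs)
        1≤𝟙 : ∀ {q} {Q : Set q} (Q? : Dec Q) → Q → 1# ≤ 𝟙 Q?
        1≤𝟙 (yes _) _ = ≤-refl
        1≤𝟙 (no ¬q) q = ⊥-elim (¬q q)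
        1≤* : ∀ {u v} → 1# ≤ u → 1# ≤ v → 1# ≤ u * v
        1≤* 1≤u 1≤v = ≤-trans (≤-reflexive (sym (*-identityˡ 1#)))
          (*-mono-≤ 0≤1 (≤-trans 0≤1 1≤v) 1≤u 1≤v)
        1≤term : 1# ≤ term M W
        1≤term = 1≤* (1≤* (1≤𝟙 (matching? M) M-matching)
                          (1≤exp (*-nonneg (+-nonneg 0≤ℓ 0≤κ) (≤⇒0≤ size≤x))))
                     (1≤* (1≤𝟙 (⋃ M ⊆? W) (⋃-⊆ M⊆W)) (≤-reflexive (sym (avoid≈1 _ rest-outside-W))))

      𝔼-≤ : ∀ {e} {E : Subset n → Set e} (E? : Decidable E) →
        (∀ W → E W → fromℕ (ν (H ⟦ W ⟧)) ≤ x + fromℕ (length (filter empty? (edges H)))) →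
        Pr p E? ≤ exp (bound-exponent + α * mass Cs)
      𝔼-≤ E? E⇒ν≤ = begin
        Pr p E?                                                      ≈⟨ Pr≈𝔼 E? ⟩
        𝔼 n (λ W → 𝟙 (E? W))                                         ≤⟨ 𝔼-mono n pointwise ⟩
        𝔼 n (λ W → sumOver (sublists Cs) (λ M → term M W))           ≈⟨ 𝔼-sumOver n (sublists Cs) term ⟩
        sumOver (sublists Cs) (λ M → 𝔼 n (term M))                   ≤⟨ sumOver-mono-All (All.tabulate λ {M} M∈ →
            𝔼-term-≤ M (All-sublists (all-filter core? (edges H)) M∈)) ⟩
        sumOver (sublists Cs) (λ M → exp bound-exponent * prodOver M (λ A → α * weight A))
                                                                     ≈⟨ sumOver-*ˡ (exp bound-exponent) (sublists Cs) _ ⟩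
        exp bound-exponent * sumOver (sublists Cs) (λ M → prodOver M (λ A → α * weight A))
          ≤⟨ *-monoʳ-≤ (exp-nonneg _) (sumOver-sublists-≤ Cs λ A → *-nonneg 0≤α (weight-nonneg A)) ⟩
        exp bound-exponent * exp (sumOver Cs (λ A → α * weight A))   ≈⟨ *-congˡ (exp-cong (sumOver-*ˡ α Cs weight)) ⟩
        exp bound-exponent * exp (α * mass Cs)                       ≈⟨ exp-+ _ _ ⟨
        exp (bound-exponent + α * mass Cs) ∎
        where
        open ≤-Reasoning
        pointwise : ∀ W → 𝟙 (E? W) ≤ sumOver (sublists Cs) (λ M → term M W)
        pointwise W with E? W
        ... | yes E-W = 1≤sumOver-terms W (E⇒ν≤ W E-W)
        ... | no _    = sumOver-nonneg (sublists Cs) (term-nonneg W)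

open import Data.Fin.Subset using (Nonempty; ∣_∣)
open import Data.Fin.Subset.Properties using (nonempty?)
open import Data.List.Base using (List; []; _∷_; filter; length)
open import Data.Product.Base using (_×_; _,_; proj₁)
open import Relation.Nullary.Decidable using (yes; no; _×-dec_)
open import Relation.Unary using (Pred)

-- The mass of the discarded edges.

module DiscardedMass {c ℓ₁ ℓ₂} (R : RealField c ℓ₁ ℓ₂) (p : RealField.Carrier R)
  (0≤p : RealField._≤_ R (RealField.0# R) p) (p≤1 : RealField._≤_ R p (RealField.1# R))
  {n : ℕ} (L : List (Subset n)) (α η : RealField.Carrier R)
  (0≤α : RealField._≤_ R (RealField.0# R) α) (0<η : RealField._<_ R (RealField.0# R) η) where
  open Reals R
  open Weights R
  open Order R
  open Sums R
  open Probability R p 0≤p p≤1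
  open SubsetWeights R p 0≤p p≤1
  open GreedyMatching

  -- The condition degree ≤ η/α, cleared of its denominator. It compares reals, so a decision
  -- procedure for it is passed around as an argument.
  Good Core : Subset n → Set ℓ₂
  Good A = α * degree L A ≤ η
  Core A = Nonempty A × Good A

  core? : Decidable Good → Decidable Core
  core? good? A = nonempty? A ×-dec good? A

  sumOver-𝟙 : ∀ {a q} {X : Set a} {Q : Pred X q} (Q? : Decidable Q) xs →
    sumOver xs (λ x → 𝟙 (Q? x)) ≈ fromℕ (length (filter Q? xs))
  sumOver-𝟙 Q? []       = refl
  sumOver-𝟙 Q? (x ∷ xs) with Q? x
  ... | yes _ = +-congˡ (sumOver-𝟙 Q? xs)
  ... | no _  = trans (+-identityˡ _) (sumOver-𝟙 Q? xs)

  private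
    s : Carrier
    s = recip η 0<η
    0≤s : 0# ≤ s
    0≤s = <⇒≤ (recip-pos η 0<η)

    -- A bad edge has 1 ≤ α * degree L A / η.
    weight-≤ : (good? : Decidable Good) → ∀ A → weight A ≤
      𝟙 (core? good? A) * weight A + 𝟙 (empty? A) + s * α * (weight A * degree L A)
    weight-≤ good? A with nonempty? A | good? A
    ... | yes _ | yes _ = ≤-by
      (solve 2 (λ w e → (:1 :* w :+ :0 :+ e) :- w := e) refl _ _)
      (*-nonneg (*-nonneg 0≤s 0≤α) (*-nonneg (weight-nonneg A) (degree-nonneg L A)))
    ... | yes _ | no bad = begin
      weight A                                        ≈⟨ *-identityʳ _ ⟨
      weight A * 1#                                   ≈⟨ *-congˡ (trans (*-comm s η) (*-recipʳ η 0<η)) ⟨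
      weight A * (s * η)                              ≤⟨ *-monoʳ-≤ (weight-nonneg A) (*-monoʳ-≤ 0≤s (≰⇒≥ bad)) ⟩
      weight A * (s * (α * degree L A))
        ≈⟨ solve 4 (λ w s α d → w :* (s :* (α :* d)) := :0 :* w :+ :0 :+ s :* α :* (w :* d)) refl _ _ _ _ ⟩
      0# * weight A + 0# + s * α * (weight A * degree L A) ∎
      where open ≤-Reasoning
    ... | no _ | _ = ≤-trans (^≤1 ∣ A ∣) (≤-by
      (solve 2 (λ w e → (:0 :* w :+ :1 :+ e) :- :1 := e) refl _ _)
      (*-nonneg (*-nonneg 0≤s 0≤α) (*-nonneg (weight-nonneg A) (degree-nonneg L A))))

  -- Markov's inequality for the degree with respect to the edge weights, followed by
  -- `sumOver-degree-≤`.
  mass-≤ : (good? : Decidable Good) → mass L ≤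
    mass (filter (core? good?) L) + fromℕ (length (filter empty? L)) + s * α * (fromℕ 2 * (p * totalOverlap L))
  mass-≤ good? = begin
    mass L
      ≤⟨ sumOver-mono L (weight-≤ good?) ⟩
    sumOver L (λ A → 𝟙 (core? good? A) * weight A + 𝟙 (empty? A) + s * α * (weight A * degree L A))
      ≈⟨ trans (sumOver-+ L _ _) (+-congʳ (sumOver-+ L _ _)) ⟩
    sumOver L (λ A → 𝟙 (core? good? A) * weight A) + sumOver L (λ A → 𝟙 (empty? A))
      + sumOver L (λ A → s * α * (weight A * degree L A))
      ≤⟨ +-mono-≤ (≤-reflexive (+-cong (sym (sumOver-filter (core? good?) L weight)) (sumOver-𝟙 empty? L)))
           (≤-trans (≤-reflexive (sumOver-*ˡ (s * α) L _))
                    (*-monoʳ-≤ (*-nonneg 0≤s 0≤α) (sumOver-degree-≤ L))) ⟩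
    mass (filter (core? good?) L) + fromℕ (length (filter empty? L)) + s * α * (fromℕ 2 * (p * totalOverlap L)) ∎
    where open ≤-Reasoning

-- Choice of the parameters and the final exponent.

mainTheorem2 : ∀ {c ℓ₁ ℓ₂} (R : RealField c ℓ₁ ℓ₂) (EL : ExpLog R) →
    let open Reals R
        open ExpLog EL
        open Weights R
    in
    ∀ (n : ℕ) (H : Hypergraph n) (p α η : Carrier) →
    0# ≤ p → p ≤ 1# →
    (0<α : 0# < α) → α ≤ 1# →
    (0<η : 0# < η) → η ≤ 1# →
    (E? : Decidable (λ (W : Subset n) → fromℕ (ν (H ⟦ W ⟧)) ≤ α * μ p H)) →
    Pr p E? ≤ exp (- (1# - α * log (e / α ⟨ 0<α ⟩) (/-pos 0<e 0<α) - α * p - η) * μ p H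
                   + (1# + fromℕ 2 * α * p / η ⟨ 0<η ⟩) * Δ p H)
mainTheorem2 R EL n H p α η 0≤p p≤1 0<α α≤1 0<η η≤1 E? =
  ≤-byDecidability n Good λ good? →
    -- The ε empty edges use up part of the allowance α * μ p H, leaving the difference for nonempty
    -- core edges.
    ≤-trans (𝔼-≤ (core? good?) proj₁ κ 0≤κ core-neighbourhood α 0≤α ℓ 0≤ℓ exp-ℓ (α * μ p H - ε) E?
               (λ W ν≤ → ≤-trans ν≤ (≤-reflexive (solve 2 (λ x e → x := (x :- e) :+ e) refl (α * μ p H) ε))))
      (exp-mono (exponent-≤ good?))
  where
  open Reals R
  open ExpLog EL
  open Weights R
  open Order R
  open Exponential R EL
  open Probability R p 0≤p p≤1
  open SubsetWeights R p 0≤p p≤1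
  open GreedyMatching
  open MatchingTail R EL H p 0≤p p≤1
  0≤α : 0# ≤ α
  0≤α = <⇒≤ 0<α
  open DiscardedMass R p 0≤p p≤1 (edges H) α η 0≤α 0<η
  ε r s Λ ℓ κ O : Carrier
  ε = fromℕ (length (filter empty? (edges H)))
  r = recip α 0<α
  s = recip η 0<η
  Λ = log (e / α ⟨ 0<α ⟩) (/-pos 0<e 0<α)
  -- Subtracting 1 from log (e/α) leaves the ℓ with exp (- ℓ) = α; the 1 returns as the term α *
  -- mass from the sum over sublists.
  ℓ = Λ - 1#
  κ = p + η * r
  O = totalOverlap (edges H)

  exp-ℓ : exp (- ℓ) ≈ α
  exp-ℓ = *-cancelˡ-≈ (/-pos 0<e 0<α) (begin
    e * r * exp (- ℓ)        ≈⟨ *-congʳ (exp-log _ (/-pos 0<e 0<α)) ⟨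
    exp Λ * exp (- ℓ)        ≈⟨ exp-+ Λ (- ℓ) ⟨
    exp (Λ + - ℓ)            ≈⟨ exp-cong (solve 1 (λ l → l :+ :- (l :- :1) := :1) refl Λ) ⟩
    e                        ≈⟨ *-identityʳ e ⟨
    e * 1#                   ≈⟨ *-congˡ (trans (*-comm r α) (*-recipʳ α 0<α)) ⟨
    e * (r * α)              ≈⟨ *-assoc e r α ⟨
    e * r * α                ∎)
    where open import Relation.Binary.Reasoning.Setoid setoid

  -- From 1 - ℓ ≤ exp (- ℓ) = α. Besides the sign of ℓ, it ensures that setting an empty edge aside
  -- gains at least as much as its weight costs.
  1-α≤ℓ : 1# - α ≤ ℓ
  1-α≤ℓ = ≤-by (solve 2 (λ l α → l :- (:1 :- α) := α :- (:1 :+ :- l)) refl ℓ α)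
    (≤⇒0≤ (≤-trans (1+x≤exp (- ℓ)) (≤-reflexive exp-ℓ)))

  0≤ℓ : 0# ≤ ℓ
  0≤ℓ = ≤-trans (≤⇒0≤ α≤1) 1-α≤ℓ

  0≤η*r : 0# ≤ η * r
  0≤η*r = <⇒≤ (*-pos 0<η (recip-pos α 0<α))

  0≤κ : 0# ≤ κ
  0≤κ = +-nonneg 0≤p 0≤η*r

  core-neighbourhood : ∀ {A} → Core A → neighbourhood (edges H) A ≤ κ
  core-neighbourhood {A} (A≠∅ , good) = begin
    neighbourhood (edges H) A       ≤⟨ neighbourhood-≤ A (unique H) ⟩
    degree (edges H) A + weight A   ≤⟨ +-mono-≤ degree-≤ (weight≤p A A≠∅) ⟩
    η * r + p                       ≈⟨ +-comm _ _ ⟩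
    κ                               ∎
    where
    open ≤-Reasoning
    degree-≤ : degree (edges H) A ≤ η * r
    degree-≤ = begin
      degree (edges H) A             ≈⟨ trans (*-congʳ (*-recipʳ α 0<α)) (*-identityˡ _) ⟨
      α * r * degree (edges H) A     ≈⟨ solve 3 (λ a r d → a :* r :* d := a :* d :* r) refl α r _ ⟩
      α * degree (edges H) A * r     ≤⟨ *-monoˡ-≤ (<⇒≤ (recip-pos α 0<α)) good ⟩
      η * r                          ∎

  exponent-≤ : (good? : Decidable Good) →
    (ℓ + κ) * (α * μ p H - ε) - mass (filter (core? good?) (edges H)) + O + α * mass (filter (core? good?) (edges H))
    ≤ - (1# - α * Λ - α * p - η) * μ p H + (1# + fromℕ 2 * α * p * s) * Δ p H
  exponent-≤ good? = ≤-trans (≤-by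
    (trans (solve 11 (λ Λ p η r α m ε m′ O s d →
        (:- (:1 :- α :* Λ :- α :* p :- η) :* m :+ (:1 :+ d :* α :* p :* s) :* O)
          :- (((Λ :- :1) :+ (p :+ η :* r)) :* (α :* m :- ε) :- m′ :+ O :+ α :* m′)
        -- The slack has three nonnegative parts: 1 - α times the slack of `mass-≤`, the net gain
        -- from empty edges, and the unspent share α of the discarded-mass bound. The final summand
        -- vanishes since α * r is 1.
        := ((:1 :- α) :* ((m′ :+ ε :+ s :* α :* (d :* (p :* O))) :- m)
           :+ (((Λ :- :1) :- (:1 :- α)) :+ (p :+ η :* r)) :* ε
           :+ α :* (s :* α :* (d :* (p :* O)))) :+ η :* m :* (:1 :- α :* r))
        refl Λ p η r α (μ p H) ε (mass (filter (core? good?) (edges H))) O s (fromℕ 2))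
      (trans (+-congˡ (trans (*-congˡ (trans (+-congˡ (-‿cong (*-recipʳ α 0<α))) (-‿inverseʳ 1#))) (zeroʳ _)))
        (+-identityʳ _)))
    (+-nonneg (+-nonneg
      (*-nonneg (≤⇒0≤ α≤1) (≤⇒0≤ (mass-≤ good?)))
      (*-nonneg (+-nonneg (≤⇒0≤ 1-α≤ℓ) 0≤κ) (fromℕ-nonneg (length (filter empty? (edges H))))))
      (*-nonneg 0≤α (*-nonneg (*-nonneg (<⇒≤ (recip-pos η 0<η)) 0≤α)
        (*-nonneg (fromℕ-nonneg 2) (*-nonneg 0≤p (totalOverlap-nonneg (edges H))))))))
    (≤-reflexive (+-congˡ (*-congˡ (sym (Δ≈totalOverlap H)))))
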